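{- Let $n\geq 1$ and $k\geq 0$ be integers, and let $X=(X_{ij})_{i,j=1}^n$ be a matrix of independent commuting indeterminates. For each multiindex $\alpha\in\mathbb{N}^{[n]\times[n]}$ with $|\alpha|=kn$, let $c_\alpha$ denote the coefficient of the monomial $X^\alpha$ in the polynomial $\det(X)^k$. Then $$\sum_{|\alpha|=kn} c_\alpha^2\,\alpha! \;=\; \frac{k!\,(k+1)!\cdots(k+n-1)!}{0!\,1!\cdots(n-1)!}.$$
   Context: Here $[n]=\{1,\ldots,n\}$. For a multiindex of nonnegative integers $\alpha=(\alpha_{ij})\in\mathbb{N}^{[n]\times[n]}$, we write $|\alpha|=\sum_{i,j=1}^n\alpha_{ij}$, $X^\alpha=\prod_{i,j=1}^n X_{ij}^{\alpha_{ij}}$, and $\alpha!=\prod_{i,j=1}^n\alpha_{ij}!$. -}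

module Defs where

open import Data.Nat as ℕ using (ℕ; zero; suc; _≤_)
open import Data.Nat using (_!)
open import Data.Integer as ℤ using (ℤ; +_)
open import Data.Fin using (Fin; zero; suc; toℕ; punchIn)
open import Data.Fin.Properties using () renaming (_≟_ to _≟F_)
open import Data.Vec as Vec using (Vec; []; _∷_)
open import Data.Vec.Properties using (≡-dec)
open import Data.List as List using (List; []; _∷_; _++_; concatMap; allFin; upTo; filterᵇ)
open import Data.Product using (_×_; _,_)
open import Data.Bool using (Bool; _∧_; if_then_else_)
open import Relation.Nullary.Decidable using (⌊_⌋)
import Data.Nat.Properties as ℕP
open import Data.Nat.ListAction using (product)

-- Multiindices α ∈ ℕ^{[n]×[n]}, stored as n×n matrices of naturals
-- (entry (i , j) is α_ij).

Mon : ℕ → Set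
Mon n = Vec (Vec ℕ n) n

zeroM : ∀ {n} → Mon n
zeroM = Vec.replicate _ (Vec.replicate _ 0)

addM : ∀ {n} → Mon n → Mon n → Mon n
addM = Vec.zipWith (Vec.zipWith ℕ._+_)

unitM : ∀ {n} → Fin n → Fin n → Mon n
unitM i j = Vec.tabulate λ a → Vec.tabulate λ b →
  if ⌊ a ≟F i ⌋ ∧ ⌊ b ≟F j ⌋ then 1 else 0

∣_∣M : ∀ {n} → Mon n → ℕ
∣ α ∣M = Vec.sum (Vec.map Vec.sum α)

factM : ∀ {n} → Mon n → ℕ
factM α = product (Vec.toList (Vec.map (λ r → product (Vec.toList (Vec.map _! r))) α))

_≟M_ : ∀ {n} (α β : Mon n) → _
_≟M_ = ≡-dec (≡-dec ℕP._≟_)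

-- Polynomials in ℤ[X_ij : i , j ∈ [n]], as formal finite sums of terms
-- c · X^α (a term list; repetitions allowed).  The coefficient of X^α
-- is the sum of the coefficients of all terms with exponent α.

Poly : ℕ → Set
Poly n = List (ℤ × Mon n)

coeff : ∀ {n} → Mon n → Poly n → ℤ
coeff α [] = + 0
coeff α ((c , β) ∷ p) = (if ⌊ α ≟M β ⌋ then c else + 0) ℤ.+ coeff α p

oneP : ∀ {n} → Poly n
oneP = (+ 1 , zeroM) ∷ []

varP : ∀ {n} → Fin n → Fin n → Poly n
varP i j = (+ 1 , unitM i j) ∷ []

_⊕_ : ∀ {n} → Poly n → Poly n → Poly n
_⊕_ = _++_

scaleP : ∀ {n} → ℤ → Poly n → Poly n
scaleP a = List.map λ { (c , β) → (a ℤ.* c , β) }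

_⊗_ : ∀ {n} → Poly n → Poly n → Poly n
p ⊗ q = concatMap (λ { (c , β) → List.map (λ { (d , γ) → (c ℤ.* d , addM β γ) }) q }) p

powP : ∀ {n} → Poly n → ℕ → Poly n
powP p zero = oneP
powP p (suc k) = p ⊗ powP p k

sgn : ∀ {m} → Fin m → ℤ
sgn j = (ℤ.- + 1) ℤ.^ toℕ j

detP : ∀ {n} m → (Fin m → Fin m → Poly n) → Poly n
detP zero A = oneP
detP (suc m) A = List.foldr _⊕_ []
  (List.map (λ j → scaleP (sgn j) (A zero j ⊗ detP m (λ r c → A (suc r) (punchIn j c))))
            (allFin (suc m)))

detX : ∀ n → Poly n
detX n = detP n varP

cCoeff : ∀ n → ℕ → Mon n → ℤ
cCoeff n k α = coeff α (powP (detX n) k)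

boxVecs : ℕ → ∀ m → List (Vec ℕ m)
boxVecs b zero = [] ∷ []
boxVecs b (suc m) = concatMap (λ x → List.map (x ∷_) (boxVecs b m)) (upTo (suc b))

boxMats : ∀ {r} → List (Vec ℕ r) → ∀ m → List (Vec (Vec ℕ r) m)
boxMats rows zero = [] ∷ []
boxMats rows (suc m) = concatMap (λ x → List.map (x ∷_) (boxMats rows m)) rows

multiindices : ∀ n → ℕ → List (Mon n)
multiindices n d = filterᵇ (λ α → ⌊ ∣ α ∣M ℕP.≟ d ⌋) (boxMats (boxVecs d n) n)

sumℤ : List ℤ → ℤ
sumℤ = List.foldr ℤ._+_ (+ 0)

prodUpTo : ℕ → (ℕ → ℕ) → ℕ
prodUpTo n f = product (List.map f (upTo n))

{-# OPTIONS --safe #-}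
module Submission where

-- For the Fischer pairing ⟨p , q⟩ = Σ_α p_α q_α α!, multiplication by X_ij is adjoint
-- to ∂_ij, so the squared norm of det(X)^(t+1) is ⟨det(X)^t , det(∂) det(X)^(t+1)⟩.
-- Cayley's identity det(∂) det(X)^(t+1) = (t+1)⋯(t+n) det(X)^t then gives the
-- norms recursively.  Cayley's identity is the case m = n of
--   det(∂_ρf) det(X)^(t+1) = (t+1)⋯(t+m) det(X)^t D(e_f),
-- where ∂_ρf consists of the last m rows and the columns f, and D(w) is the determinant
-- of X with its last m rows replaced by w.  Passing from m to m + 1, the derivative of
-- det(X)^t contributes t by a Grassmann–Plücker relation, and the derivative of
-- D contributes m + 1 by alternation.

open import Algebra.Bundles using (CommutativeRing)
open import Data.Empty using (⊥-elim)
open import Data.Fin using (Fin; zero; suc; punchIn)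
open import Data.Fin.Properties using (suc-injective) renaming (_≟_ to _≟F_)
open import Data.Nat as ℕ using (ℕ; zero; suc)
open import Data.Product using (_×_; _,_; proj₁; proj₂)
open import Data.Unit.Polymorphic using (⊤; tt)
open import Function using (_∘_; id)
open import Function.Definitions using (Injective)
open import Level using (_⊔_)
open import Relation.Binary.PropositionalEquality as ≡ using (_≡_; _≢_)

-- The closed form survives the induction because the two terms of the product rule turn out to be
-- multiples of one expression. Differentiating det(X)^t lowers the power by one and leaves an
-- alternating sum of products of two determinants; the exchange relation collapses that sum to
-- det(X) D(e_f), which restores the lost power. The scalars then add up to t + (m + 1), the next
-- factor of `rising`. Determinants that mix rows of X with unit vectors would need heavy index
-- bookkeeping. Instead the induction carries an arbitrary function `D` of m rows. Fixing one more
-- row of X is precomposition with `x ∷_`, and only four properties have to survive it: congruence,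
-- alternation, differentiation in the first row, and exchange. This algebra takes place in any
-- commutative ring with suitable derivations; term lists modulo `_≈ₚ_` are one instance.

rising : ℕ → ℕ → ℕ
rising t zero    = 1
rising t (suc m) = rising t m ℕ.* (t ℕ.+ suc m)

module Determinant {c ℓ} (R : CommutativeRing c ℓ) where
  open CommutativeRing R hiding (zero)
  open import Data.Vec.Functional using (_∷_)
  open import Algebra.Properties.Ring ring
    using (-0#≈0#; -‿involutive; -‿distribʳ-*; -‿distribˡ-*; -‿+-comm)
  open import Algebra.Properties.CommutativeSemigroup *-commutativeSemigroup
    using () renaming (x∙yz≈y∙xz to x*yz≈y*xz)
  open import Algebra.Properties.CommutativeSemigroup +-commutativeSemigroup
    using () renaming (interchange to +-medial)
  open import Algebra.Properties.Semiring.Mult semiring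
    using (×-homo-+; ×1-homo-*) renaming (_×_ to _·_)
  open import Relation.Binary.Reasoning.Setoid setoid

  private variable
    m n : ℕ

  -- Subtraction and alternating sums.

  x-0≈x : ∀ x → x - 0# ≈ x
  x-0≈x x = trans (+-congˡ -0#≈0#) (+-identityʳ x)

  +≈0⇒≈- : ∀ {x y} → x + y ≈ 0# → x ≈ - y
  +≈0⇒≈- {x} {y} eq = begin
    x              ≈⟨ +-identityʳ x ⟨
    x + 0#         ≈⟨ +-congˡ (-‿inverseʳ y) ⟨
    x + (y - y)    ≈⟨ +-assoc x y (- y) ⟨
    (x + y) - y    ≈⟨ +-congʳ eq ⟩
    0# - y         ≈⟨ +-identityˡ (- y) ⟩
    - y            ∎

  -≈0⇒≈ : ∀ {x y} → x - y ≈ 0# → x ≈ y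
  -≈0⇒≈ eq = trans (+≈0⇒≈- eq) (-‿involutive _)

  -‿cong₂ : ∀ {x y u v} → x ≈ y → u ≈ v → x - u ≈ y - v
  -‿cong₂ p q = +-cong p (-‿cong q)

  *-distribˡ-minus : ∀ a x y → a * (x - y) ≈ a * x - a * y
  *-distribˡ-minus a x y = trans (distribˡ a x (- y)) (+-congˡ (sym (-‿distribʳ-* a y)))

  minus-medial : ∀ a b x y → (a - b) + (x - y) ≈ (a + x) - (b + y)
  minus-medial a b x y = trans (+-medial a (- b) x (- y)) (+-congˡ (-‿+-comm b y))

  -- Opaque, because a sum over Fin (suc m) that unfolds by itself defeats unification.
  opaque
    alt : (Fin m → Carrier) → Carrier
    alt {zero}  f = 0#
    alt {suc m} f = f zero - alt (f ∘ suc)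

    alt-zero : (f : Fin 0 → Carrier) → alt f ≈ 0#
    alt-zero f = refl

    alt-suc : (f : Fin (suc m) → Carrier) → alt f ≈ f zero - alt (f ∘ suc)
    alt-suc f = refl

  opaque
    unfolding alt

    alt-cong : {f g : Fin m → Carrier} → (∀ i → f i ≈ g i) → alt f ≈ alt g
    alt-cong {zero}  eq = refl
    alt-cong {suc m} eq = -‿cong₂ (eq zero) (alt-cong (eq ∘ suc))

    alt-0 : {f : Fin m → Carrier} → (∀ i → f i ≈ 0#) → alt f ≈ 0#
    alt-0 {zero}  eq = refl
    alt-0 {suc m} eq = trans (-‿cong₂ (eq zero) (alt-0 (eq ∘ suc))) (-‿inverseʳ 0#)

    -- One induction that serves scalar multiplication, negation and derivations alike.
    alt-hom : (h : Carrier → Carrier) → h 0# ≈ 0# → (∀ x y → h (x - y) ≈ h x - h y) →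
              (f : Fin m → Carrier) → h (alt f) ≈ alt (h ∘ f)
    alt-hom {zero}  h h0 h- f = h0
    alt-hom {suc m} h h0 h- f =
      trans (h- _ _) (+-congˡ (-‿cong (alt-hom h h0 h- (f ∘ suc))))

  *-alt : ∀ a (f : Fin m → Carrier) → a * alt f ≈ alt (λ i → a * f i)
  *-alt a = alt-hom (a *_) (zeroʳ a) (*-distribˡ-minus a)

  alt-* : ∀ (f : Fin m → Carrier) a → alt f * a ≈ alt (λ i → f i * a)
  alt-* f a = trans (*-comm _ _) (trans (*-alt a f) (alt-cong λ i → *-comm a (f i)))

  -alt : ∀ (f : Fin m → Carrier) → - alt f ≈ alt (λ i → - f i)
  -alt = alt-hom -_ -0#≈0# (λ x y → sym (-‿+-comm x (- y)))

  alt-+ : ∀ (f g : Fin m → Carrier) → alt (λ i → f i + g i) ≈ alt f + alt g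
  alt-+ {zero}  f g = trans (alt-zero _) (sym (trans (+-cong (alt-zero f) (alt-zero g)) (+-identityʳ 0#)))
  alt-+ {suc m} f g = begin
    alt (λ i → f i + g i)
      ≈⟨ alt-suc _ ⟩
    (f zero + g zero) - alt (λ i → f (suc i) + g (suc i))
      ≈⟨ +-congˡ (-‿cong (alt-+ (f ∘ suc) (g ∘ suc))) ⟩
    (f zero + g zero) - (alt (f ∘ suc) + alt (g ∘ suc))
      ≈⟨ minus-medial _ _ _ _ ⟨
    (f zero - alt (f ∘ suc)) + (g zero - alt (g ∘ suc))
      ≈⟨ +-cong (alt-suc f) (alt-suc g) ⟨
    alt f + alt g ∎

  alt-minus : ∀ (f g : Fin m → Carrier) → alt (λ i → f i - g i) ≈ alt f - alt g
  alt-minus f g = trans (alt-+ f (-_ ∘ g)) (+-congˡ (sym (-alt g)))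

  alt-swap : ∀ (F : Fin m → Fin n → Carrier) →
             alt (λ i → alt (λ j → F i j)) ≈ alt (λ j → alt (λ i → F i j))
  alt-swap {zero}  F = trans (alt-zero _) (sym (alt-0 λ j → alt-zero _))
  alt-swap {suc m} F = begin
    alt (λ i → alt (λ j → F i j))                                ≈⟨ alt-suc _ ⟩
    alt (F zero) - alt (λ i → alt (λ j → F (suc i) j))           ≈⟨ +-congˡ (-‿cong (alt-swap (F ∘ suc))) ⟩
    alt (F zero) - alt (λ j → alt (λ i → F (suc i) j))           ≈⟨ alt-minus _ _ ⟨
    alt (λ j → F zero j - alt (λ i → F (suc i) j))               ≈⟨ alt-cong (λ j → alt-suc _) ⟨
    alt (λ j → alt (λ i → F i j))                                ∎

  -- Double alternating sums over ordered pairs a ≠ b, together with the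
  -- increasing enumeration of the complement of {a , b}.
  altPairs : (Fin (2 ℕ.+ m) → Fin (2 ℕ.+ m) → (Fin m → Fin (2 ℕ.+ m)) → Carrier) → Carrier
  altPairs G = alt λ j → alt λ l → G j (punchIn j l) (punchIn j ∘ punchIn l)

  -- Different compositions of `punchIn` that enumerate the same complement agree only pointwise, so
  -- `G` has to respect pointwise equality.
  RestCong : (Fin n → Fin n → (Fin m → Fin n) → Carrier) → Set ℓ
  RestCong G = ∀ a b {r s} → (∀ x → r x ≡ s x) → G a b r ≈ G a b s

  -- The pairs (a , b) and (b , a) carry opposite signs, since deleting the smaller index shifts the
  -- larger one down by one. The pairs containing 0 form `A` and `alt B`, which cancel; those
  -- avoiding 0 form a sum of the same kind over fewer indices.
  altPairs-symmetric : (G : Fin (2 ℕ.+ m) → Fin (2 ℕ.+ m) → (Fin m → Fin (2 ℕ.+ m)) → Carrier) →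
    RestCong G → (∀ a b r → G a b r ≈ G b a r) → altPairs G ≈ 0#
  altPairs-symmetric {m} G G-cong G-sym = begin
    altPairs G                      ≈⟨ alt-suc _ ⟩
    A - alt (λ j → alt λ l → G (suc j) (punchIn (suc j) l) (punchIn (suc j) ∘ punchIn l))
                                    ≈⟨ +-congˡ (-‿cong (alt-cong λ j → alt-suc _)) ⟩
    A - alt (λ j → B j - C j)       ≈⟨ +-congˡ (-‿cong (alt-minus B C)) ⟩
    A - (alt B - alt C)             ≈⟨ -‿cong₂ A≈B (trans (+-congˡ (-‿cong (C≈0 m G G-cong G-sym))) (x-0≈x _)) ⟩
    alt B - alt B                   ≈⟨ -‿inverseʳ _ ⟩
    0#                              ∎
    where
    A = alt λ l → G zero (suc l) (suc ∘ punchIn l)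
    B = λ j → G (suc j) zero (suc ∘ punchIn j)
    C = λ j → alt λ l → G (suc j) (suc (punchIn j l)) (punchIn (suc j) ∘ punchIn (suc l))
    A≈B : A ≈ alt B
    A≈B = alt-cong λ l → G-sym _ _ _
    C≈0 : ∀ m (G : Fin (2 ℕ.+ m) → Fin (2 ℕ.+ m) → (Fin m → Fin (2 ℕ.+ m)) → Carrier) →
      RestCong G → (∀ a b r → G a b r ≈ G b a r) →
      alt (λ j → alt λ l → G (suc j) (suc (punchIn j l)) (punchIn (suc j) ∘ punchIn (suc l))) ≈ 0#
    C≈0 zero    G G-cong G-sym = alt-0 λ j → alt-zero _
    C≈0 (suc m) G G-cong G-sym = trans
      (alt-cong λ j → alt-cong λ l → G-cong _ _ λ { zero → ≡.refl ; (suc x) → ≡.refl })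
      -- The complement of a pair that avoids 0 contains 0, so 0 is put back in front of the shifted
      -- enumeration.
      (altPairs-symmetric (λ a b r → G (suc a) (suc b) (zero ∷ (suc ∘ r)))
        (λ a b eq → G-cong _ _ λ { zero → ≡.refl ; (suc x) → ≡.cong suc (eq x) })
        (λ a b r → G-sym _ _ _))

  altPairs-+ : ∀ (G H : Fin (2 ℕ.+ m) → Fin (2 ℕ.+ m) → (Fin m → Fin (2 ℕ.+ m)) → Carrier) →
    altPairs (λ a b r → G a b r + H a b r) ≈ altPairs G + altPairs H
  altPairs-+ G H = trans (alt-cong λ j → alt-+ _ _) (alt-+ _ _)

  -- `G` plus its transpose is symmetric, so their sums cancel.
  altPairs-antisym : (G : Fin (2 ℕ.+ m) → Fin (2 ℕ.+ m) → (Fin m → Fin (2 ℕ.+ m)) → Carrier) →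
    RestCong G → altPairs G ≈ - altPairs (λ a b → G b a)
  altPairs-antisym G G-cong = +≈0⇒≈- (trans (sym (altPairs-+ G (λ a b → G b a)))
    (altPairs-symmetric _ (λ a b eq → +-cong (G-cong a b eq) (G-cong b a eq))
      (λ a b r → +-comm _ _)))

  -- Determinants by Laplace expansion.

  infix 4 _≋_
  _≋_ : {a b : Set} (A B : a → b → Carrier) → Set ℓ
  A ≋ B = ∀ i j → A i j ≈ B i j

  det : (Fin m → Fin m → Carrier) → Carrier
  det {zero}  A = 1#
  det {suc m} A = alt λ j → A zero j * det (λ r c → A (suc r) (punchIn j c))

  det-cong : {A B : Fin m → Fin m → Carrier} → A ≋ B → det A ≈ det B
  det-cong {zero}  eq = refl
  det-cong {suc m} eq =
    alt-cong λ j → *-cong (eq zero j) (det-cong λ r c → eq (suc r) (punchIn j c))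

  det-reindex : (V : Fin m → Fin n → Carrier) {r s : Fin m → Fin n} → (∀ x → r x ≡ s x) →
                det (λ i x → V i (r x)) ≈ det (λ i x → V i (s x))
  det-reindex V eq = det-cong λ i x → reflexive (≡.cong (V i) (eq x))

  -- The corner entry contributes the same term to the row and the column expansion. Every other
  -- minor of the row expansion is expanded along its own first column, and interchanging the two
  -- sums gives the remaining terms.
  det-column : (A : Fin (suc m) → Fin (suc m) → Carrier) →
               det A ≈ alt (λ i → A i zero * det (λ r c → A (punchIn i r) (suc c)))
  det-column {zero}  A = alt-cong λ { zero → refl }
  det-column {suc m} A = trans (alt-suc _) (trans (+-congˡ (-‿cong (begin
    alt (λ j → A zero (suc j) * det (λ r c → A (suc r) (punchIn (suc j) c)))
      ≈⟨ alt-cong (λ j → trans (*-congˡ (det-column λ r c → A (suc r) (punchIn (suc j) c))) (*-alt _ _)) ⟩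
    alt (λ j → alt λ i → A zero (suc j) * (A (suc i) zero * M i j))
      ≈⟨ alt-swap _ ⟩
    alt (λ i → alt λ j → A zero (suc j) * (A (suc i) zero * M i j))
      ≈⟨ alt-cong (λ i → trans (alt-cong λ j → x*yz≈y*xz _ _ _) (sym (*-alt _ _))) ⟩
    alt (λ i → A (suc i) zero * det (λ r c → A (punchIn (suc i) r) (suc c)))
      ∎))) (sym (alt-suc _)))
    where M = λ i j → det λ r c → A (suc (punchIn i r)) (suc (punchIn j c))

  det-transpose : (A : Fin m → Fin m → Carrier) → det A ≈ det (λ i j → A j i)
  det-transpose {zero}  A = refl
  det-transpose {suc m} A =
    trans (det-column A) (alt-cong λ j → *-congˡ (det-transpose λ r c → A (punchIn j r) (suc c)))

  -- This is the expansion of a square matrix with row `i` of `V` repeated on top. For the first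
  -- row, expanding the minors gives a summand symmetric in the two chosen columns. For a later row,
  -- exchanging the two columns pulls the first row out, and the inner sum is the same statement for
  -- `V` without that row and one column.
  columns-dependent : (V : Fin n → Fin (suc n) → Carrier) (i : Fin n) →
    alt (λ j → V i j * det (λ r c → V r (punchIn j c))) ≈ 0#
  columns-dependent V zero = trans
    (alt-cong λ j → *-alt _ _)
    (altPairs-symmetric (λ a b r → V zero a * (V zero b * det (λ x y → V (suc x) (r y))))
      (λ a b eq → *-congˡ (*-congˡ (det-reindex (V ∘ suc) eq)))
      (λ a b r → x*yz≈y*xz _ _ _))
  columns-dependent {suc n} V (suc i) = begin
    alt (λ j → V (suc i) j * det (λ r c → V r (punchIn j c)))
      ≈⟨ alt-cong (λ j → *-alt _ _) ⟩
    altPairs G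
      ≈⟨ altPairs-antisym G (λ a b eq → *-congˡ (*-congˡ (det-reindex (V ∘ suc) eq))) ⟩
    - altPairs (λ a b → G b a)
      ≈⟨ -‿cong (alt-cong λ j → trans (alt-cong λ l → x*yz≈y*xz _ _ _) (sym (*-alt _ _))) ⟩
    - alt (λ j → V zero j * alt λ l → V (suc i) (punchIn j l) * det (λ x y → V (suc x) (punchIn j (punchIn l y))))
      ≈⟨ -‿cong (alt-0 λ j → trans (*-congˡ (columns-dependent (λ x y → V (suc x) (punchIn j y)) i)) (zeroʳ _)) ⟩
    - 0#
      ≈⟨ -0#≈0# ⟩
    0# ∎
    where G = λ a b r → V (suc i) a * (V zero b * det (λ x y → V (suc x) (r y)))

  rows-dependent : (V : Fin (suc n) → Fin n → Carrier) (i : Fin n) →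
    alt (λ j → V j i * det (λ r c → V (punchIn j r) c)) ≈ 0#
  rows-dependent V i = trans
    (alt-cong λ j → *-congˡ (det-transpose λ r c → V (punchIn j r) c))
    (columns-dependent (λ r c → V c r) i)

  -- Alternating functions of rows.

  RowFunction : ℕ → ℕ → Set c
  RowFunction n m = (Fin m → Fin n → Carrier) → Carrier

  Congruent : RowFunction n m → Set (c ⊔ ℓ)
  Congruent D = ∀ {u v} → u ≋ v → D u ≈ D v

  -- Conditions on adjacent rows only, stated recursively. Vanishing on a repeated row is separate,
  -- because antisymmetry alone gives just twice the value equal to zero in a general ring.
  Alternating : RowFunction n m → Set (c ⊔ ℓ)
  Alternating {n} {zero}        D = ⊤
  Alternating {n} {suc zero}    D = ⊤
  Alternating {n} {suc (suc m)} D =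
    (∀ a b u → D (a ∷ b ∷ u) ≈ - D (b ∷ a ∷ u)) ×
    (∀ a u → D (a ∷ a ∷ u) ≈ 0#) ×
    (∀ a → Alternating (D ∘ (a ∷_)))

  alternating-tail : (D : RowFunction n (suc m)) → Alternating D → ∀ a → Alternating (D ∘ (a ∷_))
  alternating-tail {m = zero}  D D-alt a = tt
  alternating-tail {m = suc m} D D-alt a = proj₂ (proj₂ D-alt) a

  -- With its first row fixed, a determinant is such a combination of smaller minors; this carries
  -- alternation to the later rows.
  alternating-combination : ∀ {k} (a : Fin k → Carrier) (D : Fin k → RowFunction n m) →
    (∀ j → Alternating (D j)) → Alternating (λ w → alt λ j → a j * D j w)
  alternating-combination {m = zero}        a D D-alt = tt
  alternating-combination {m = suc zero}    a D D-alt = tt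
  alternating-combination {m = suc (suc m)} a D D-alt =
    (λ x y u → trans
      (alt-cong λ j → trans (*-congˡ (proj₁ (D-alt j) x y u)) (sym (-‿distribʳ-* _ _)))
      (sym (-alt _))) ,
    (λ x u → alt-0 λ j → trans (*-congˡ (proj₁ (proj₂ (D-alt j)) x u)) (zeroʳ _)) ,
    (λ x → alternating-combination a (λ j w → D j (x ∷ w)) (λ j → proj₂ (proj₂ (D-alt j)) x))

  -- The column selection `κ` is arbitrary so that the induction can pass to minors with a column
  -- deleted. Expanding along the first two rows gives an `altPairs`, in which exchanging the rows
  -- is exchanging the two column indices.
  minor-alternating : (κ : Fin m → Fin n) → Alternating {n} {m} (λ w → det λ r c → w r (κ c))
  minor-alternating {zero}          κ = tt
  minor-alternating {suc zero}      κ = tt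
  minor-alternating {suc (suc m)} {n} κ =
    (λ x y u → trans (expand x y u) (trans
      (altPairs-antisym (G x y u) (G-cong x y u))
      (-‿cong (trans (alt-cong λ j → alt-cong λ l → x*yz≈y*xz _ _ _) (sym (expand y x u)))))) ,
    (λ x u → trans (expand x x u)
      (altPairs-symmetric (G x x u) (G-cong x x u) (λ a b r → x*yz≈y*xz _ _ _))) ,
    (λ x → alternating-combination (x ∘ κ) (λ j w → det λ r c → w r (κ (punchIn j c)))
      (λ j → minor-alternating (κ ∘ punchIn j)))
    where
    G : (x y : Fin n → Carrier) (u : Fin m → Fin n → Carrier) →
        Fin (2 ℕ.+ m) → Fin (2 ℕ.+ m) → (Fin m → Fin (2 ℕ.+ m)) → Carrier
    G x y u a b r = x (κ a) * (y (κ b) * det (λ i c → u i (κ (r c))))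
    G-cong : ∀ x y u → RestCong (G x y u)
    G-cong x y u a b eq = *-congˡ (*-congˡ (det-reindex (λ i → u i ∘ κ) eq))
    expand : ∀ x y u → det (λ r c → (x ∷ y ∷ u) r (κ c)) ≈ altPairs (G x y u)
    expand x y u = alt-cong λ j → *-alt _ _

  fromℕ : ℕ → Carrier
  fromℕ k = k · 1#

  ∷-cong : {a b : Fin n → Carrier} {u v : Fin m → Fin n → Carrier} →
           (∀ i → a i ≈ b i) → u ≋ v → (a ∷ u) ≋ (b ∷ v)
  ∷-cong p q zero    = p
  ∷-cong p q (suc i) = q i

  head∷tail : (w : Fin (suc m) → Fin n → Carrier) → (w zero ∷ (w ∘ suc)) ≋ w
  head∷tail w zero    c = refl
  head∷tail w (suc r) c = refl

  ∷-punchIn : (a : Fin n → Carrier) (w : Fin (suc m) → Fin n → Carrier) (j : Fin (suc m)) →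
              ((a ∷ w) ∘ punchIn (suc j)) ≋ (a ∷ (w ∘ punchIn j))
  ∷-punchIn a w j zero    c = refl
  ∷-punchIn a w j (suc r) c = refl

  -- Bringing row `j` to the front takes `j` adjacent exchanges, whose sign cancels that of the
  -- `j`-th term. All m + 1 terms are therefore equal to `D w`.
  alternating-cycle : (D : RowFunction n (suc m)) → Congruent D → Alternating D → ∀ w →
    alt (λ j → D (w j ∷ (w ∘ punchIn j))) ≈ fromℕ (suc m) * D w
  alternating-cycle {m = zero} D D-cong D-alt w = begin
    alt (λ j → D (w j ∷ (w ∘ punchIn j)))
      ≈⟨ alt-suc _ ⟩
    D (w zero ∷ (w ∘ suc)) - alt (λ j → D (w (suc j) ∷ (w ∘ punchIn (suc j))))
      ≈⟨ +-congˡ (-‿cong (alt-zero _)) ⟩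
    D (w zero ∷ (w ∘ suc)) - 0#  ≈⟨ x-0≈x _ ⟩
    D (w zero ∷ (w ∘ suc))       ≈⟨ D-cong (head∷tail w) ⟩
    D w                          ≈⟨ *-identityˡ _ ⟨
    1# * D w                     ≈⟨ *-congʳ (+-identityʳ 1#) ⟨
    fromℕ 1 * D w                ∎
  alternating-cycle {n} {m = suc m} D D-cong D-alt w = begin
    alt (λ j → D (w j ∷ (w ∘ punchIn j)))
      ≈⟨ alt-suc _ ⟩
    D (x ∷ v) - alt (λ j → D (v j ∷ (w ∘ punchIn (suc j))))
      ≈⟨ -‿cong₂ (D-cong (head∷tail w)) (alt-cong λ j → trans
           (D-cong (∷-cong (λ i → refl) (rest j)))
           (proj₁ D-alt (v j) x (v ∘ punchIn j))) ⟩
    D w - alt (λ j → - D (x ∷ v j ∷ (v ∘ punchIn j)))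
      ≈⟨ +-congˡ (trans (-alt _) (alt-cong λ j → -‿involutive _)) ⟩
    D w + alt (λ j → D (x ∷ v j ∷ (v ∘ punchIn j)))
      ≈⟨ +-congˡ (alternating-cycle (D ∘ (x ∷_)) (λ eq → D-cong (∷-cong (λ i → refl) eq))
           (alternating-tail D D-alt x) v) ⟩
    D w + fromℕ (suc m) * D (x ∷ v)
      ≈⟨ +-cong (sym (*-identityˡ _)) (*-congˡ (D-cong (head∷tail w))) ⟩
    1# * D w + fromℕ (suc m) * D w
      ≈⟨ distribʳ _ _ _ ⟨
    fromℕ (2 ℕ.+ m) * D w ∎
    where
    x = w zero
    v = w ∘ suc
    rest : ∀ j → (w ∘ punchIn (suc j)) ≋ (x ∷ (v ∘ punchIn j))
    rest j zero    c = refl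
    rest j (suc r) c = refl

  -- Derivations.

  record IsDerivation (∂ : Carrier → Carrier) : Set (c ⊔ ℓ) where
    field
      cong    : ∀ {x y} → x ≈ y → ∂ x ≈ ∂ y
      +-homo  : ∀ x y → ∂ (x + y) ≈ ∂ x + ∂ y
      leibniz : ∀ x y → ∂ (x * y) ≈ ∂ x * y + x * ∂ y

    0-homo : ∂ 0# ≈ 0#
    0-homo = begin
      ∂ 0#                 ≈⟨ cong (zeroˡ 0#) ⟨
      ∂ (0# * 0#)          ≈⟨ leibniz 0# 0# ⟩
      ∂ 0# * 0# + 0# * ∂ 0#  ≈⟨ +-cong (zeroʳ _) (zeroˡ _) ⟩
      0# + 0#              ≈⟨ +-identityʳ 0# ⟩
      0#                   ∎

    -‿homo : ∀ x → ∂ (- x) ≈ - ∂ x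
    -‿homo x = +≈0⇒≈- (trans (sym (+-homo _ _)) (trans (cong (-‿inverseˡ x)) 0-homo))

    1-homo : ∂ 1# ≈ 0#
    1-homo = begin
      ∂ 1#                      ≈⟨ +-identityʳ _ ⟨
      ∂ 1# + 0#                 ≈⟨ +-congˡ (-‿inverseʳ _) ⟨
      ∂ 1# + (∂ 1# - ∂ 1#)      ≈⟨ +-assoc _ _ _ ⟨
      ∂ 1# + ∂ 1# - ∂ 1#        ≈⟨ +-congʳ (+-cong (*-identityʳ _) (*-identityˡ _)) ⟨
      ∂ 1# * 1# + 1# * ∂ 1# - ∂ 1#  ≈⟨ +-congʳ (leibniz 1# 1#) ⟨
      ∂ (1# * 1#) - ∂ 1#        ≈⟨ +-congʳ (cong (*-identityˡ 1#)) ⟩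
      ∂ 1# - ∂ 1#               ≈⟨ -‿inverseʳ _ ⟩
      0#                        ∎

    fromℕ-homo : ∀ k → ∂ (fromℕ k) ≈ 0#
    fromℕ-homo zero    = 0-homo
    fromℕ-homo (suc k) = trans (+-homo _ _) (trans (+-cong 1-homo (fromℕ-homo k)) (+-identityʳ 0#))

    *-constant : ∀ {x y} → ∂ y ≈ 0# → ∂ (x * y) ≈ ∂ x * y
    *-constant eq = trans (leibniz _ _)
      (trans (+-congˡ (trans (*-congˡ eq) (zeroʳ _))) (+-identityʳ _))

    constant-* : ∀ {x y} → ∂ x ≈ 0# → ∂ (x * y) ≈ x * ∂ y
    constant-* eq = trans (leibniz _ _)
      (trans (+-congʳ (trans (*-congʳ eq) (zeroˡ _))) (+-identityˡ _))

    alt-homo : (f : Fin m → Carrier) → ∂ (alt f) ≈ alt (∂ ∘ f)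
    alt-homo = alt-hom ∂ 0-homo λ x y → trans (+-homo _ _) (+-congˡ (-‿homo y))

    det-constant : (A : Fin m → Fin m → Carrier) → (∀ i j → ∂ (A i j) ≈ 0#) → ∂ (det A) ≈ 0#
    det-constant {zero}  A eq = 1-homo
    det-constant {suc m} A eq = trans (alt-homo _) (alt-0 λ j → begin
      ∂ (A zero j * det (λ r c → A (suc r) (punchIn j c)))
        ≈⟨ *-constant (det-constant _ λ r c → eq (suc r) (punchIn j c)) ⟩
      ∂ (A zero j) * det (λ r c → A (suc r) (punchIn j c))
        ≈⟨ *-congʳ (eq zero j) ⟩
      0# * det (λ r c → A (suc r) (punchIn j c))
        ≈⟨ zeroˡ _ ⟩
      0# ∎)

  -- Powers, the identity matrix and the Grassmann-Plücker relations.

  infixr 8 _^_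
  _^_ : Carrier → ℕ → Carrier
  x ^ zero  = 1#
  x ^ suc k = x * x ^ k

  δ : Fin n → Fin n → Carrier
  δ zero    zero    = 1#
  δ zero    (suc j) = 0#
  δ (suc i) zero    = 0#
  δ (suc i) (suc j) = δ i j

  δ-refl : ∀ (i : Fin n) → δ i i ≡ 1#
  δ-refl zero    = ≡.refl
  δ-refl (suc i) = δ-refl i

  δ-≢ : {i j : Fin n} → i ≢ j → δ i j ≡ 0#
  δ-≢ {i = zero}  {zero}  i≢j = ⊥-elim (i≢j ≡.refl)
  δ-≢ {i = zero}  {suc j} i≢j = ≡.refl
  δ-≢ {i = suc i} {zero}  i≢j = ≡.refl
  δ-≢ {i = suc i} {suc j} i≢j = δ-≢ (i≢j ∘ ≡.cong suc)

  det-δ : ∀ m → det (δ {m}) ≈ 1#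
  det-δ zero    = refl
  det-δ (suc m) = begin
    det (δ {suc m})
      ≈⟨ alt-suc _ ⟩
    1# * det (δ {m}) - alt (λ j → 0# * det (λ r c → δ (suc r) (punchIn (suc j) c)))
      ≈⟨ -‿cong₂ (*-identityˡ _) (alt-0 λ j → zeroˡ _) ⟩
    det (δ {m}) - 0#
      ≈⟨ x-0≈x _ ⟩
    det (δ {m})
      ≈⟨ det-δ m ⟩
    1# ∎

  -- The Grassmann–Plücker relations between values of D.
  Exchange : RowFunction n m → Set (c ⊔ ℓ)
  Exchange {m = zero}      D = ⊤
  Exchange {n} {m = suc m} D = ∀ (u : Fin m → Fin n → Carrier) (w : Fin (2 ℕ.+ m) → Fin n → Carrier) →
    alt (λ j → D (w j ∷ u) * D (w ∘ punchIn j)) ≈ 0#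

  -- Expanding the first factor along its first row gives cofactors `μ k` that are independent of
  -- `j`. For each `k` the sum over `j` is then a linear dependency among the rows of `w`.
  det-exchange : ∀ n → Exchange {n} det
  det-exchange zero    = tt
  det-exchange (suc n) u w = begin
    alt (λ j → alt (λ k → w j k * μ k) * det (w ∘ punchIn j))
      ≈⟨ alt-cong (λ j → trans (alt-* _ _) (alt-cong λ k → trans (*-congʳ (*-comm _ _)) (*-assoc _ _ _))) ⟩
    alt (λ j → alt λ k → μ k * (w j k * det (w ∘ punchIn j)))
      ≈⟨ alt-swap _ ⟩
    alt (λ k → alt λ j → μ k * (w j k * det (w ∘ punchIn j)))
      ≈⟨ alt-0 (λ k → trans (sym (*-alt _ _)) (trans (*-congˡ (rows-dependent w k)) (zeroʳ _))) ⟩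
    0# ∎
    where μ = λ k → det λ r c → u r (punchIn k c)

  -- Adding `x` to both lists in the relation for `D` creates one extra term, which contains
  -- `D (x ∷ x ∷ u)` and vanishes. The sign from shifting the other terms is undone by exchanging
  -- the first two rows of their first factor.
  exchange-tail : (D : RowFunction n (suc m)) → Congruent D → Alternating D → Exchange D →
                  ∀ x → Exchange (D ∘ (x ∷_))
  exchange-tail {m = zero}  D D-cong D-alt D-ex x = tt
  exchange-tail {m = suc m} D D-cong (D-swap , D-repeat , _) D-ex x u w = begin
    alt (λ j → D (x ∷ w j ∷ u) * D (x ∷ (w ∘ punchIn j)))
      ≈⟨ alt-cong (λ j → *-cong (D-swap x (w j) u) (D-cong λ r c → sym (∷-punchIn x w j r c))) ⟩
    alt (λ j → - D (w j ∷ x ∷ u) * D ((x ∷ w) ∘ punchIn (suc j)))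
      ≈⟨ alt-cong (λ j → sym (-‿distribˡ-* _ _)) ⟩
    alt (λ j → - (D (w j ∷ x ∷ u) * D ((x ∷ w) ∘ punchIn (suc j))))
      ≈⟨ -alt _ ⟨
    - alt (λ j → D (w j ∷ x ∷ u) * D ((x ∷ w) ∘ punchIn (suc j)))
      ≈⟨ +-identityˡ _ ⟨
    0# - alt (λ j → D (w j ∷ x ∷ u) * D ((x ∷ w) ∘ punchIn (suc j)))
      ≈⟨ +-congʳ (trans (*-congʳ (D-repeat x u)) (zeroˡ _)) ⟨
    D (x ∷ x ∷ u) * D w - alt (λ j → D (w j ∷ x ∷ u) * D ((x ∷ w) ∘ punchIn (suc j)))
      ≈⟨ alt-suc _ ⟨
    alt (λ j → D ((x ∷ w) j ∷ x ∷ u) * D ((x ∷ w) ∘ punchIn j))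
      ≈⟨ D-ex (x ∷ u) (x ∷ w) ⟩
    0# ∎

  -- The relation for the list `x ∷ w`, with its first term moved to the other side.
  exchange-rows : (D : RowFunction n (suc m)) → Congruent D → Exchange D → ∀ x u w →
    alt (λ j → D (w j ∷ u) * D (x ∷ (w ∘ punchIn j))) ≈ D (x ∷ u) * D w
  exchange-rows D D-cong D-ex x u w = sym (-≈0⇒≈ (begin
    D (x ∷ u) * D w - alt (λ j → D (w j ∷ u) * D (x ∷ (w ∘ punchIn j)))
      ≈⟨ +-congˡ (-‿cong (alt-cong λ j → *-congˡ (D-cong λ r c → sym (∷-punchIn x w j r c)))) ⟩
    D (x ∷ u) * D w - alt (λ j → D (w j ∷ u) * D ((x ∷ w) ∘ punchIn (suc j)))
      ≈⟨ alt-suc _ ⟨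
    alt (λ j → D ((x ∷ w) j ∷ u) * D ((x ∷ w) ∘ punchIn j))
      ≈⟨ D-ex u (x ∷ w) ⟩
    0# ∎))

  -- Cayley's identity.

  module Cayley {n} (X : Fin n → Fin n → Carrier) (∂ : Fin n → Fin n → Carrier → Carrier)
    (∂-derivation : ∀ i j → IsDerivation (∂ i j))
    (∂X : ∀ i j l → ∂ i j (X i l) ≈ δ j l)
    (∂X-other : ∀ {i k} → i ≢ k → ∀ j l → ∂ i j (X k l) ≈ 0#)
    where

    private module ∂ i j = IsDerivation (∂-derivation i j)

    -- The minor det(∂_{ρ(r),f(c)}) as a differential operator.
    detOp : (ρ f : Fin m → Fin n) → Carrier → Carrier
    detOp {zero}  ρ f x = x
    detOp {suc m} ρ f x = alt λ j → ∂ (ρ zero) (f j) (detOp (ρ ∘ suc) (f ∘ punchIn j) x)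

    Constant : Fin n → Fin n → (Fin m → Fin n → Carrier) → Set ℓ
    Constant i j u = ∀ r c → ∂ i j (u r c) ≈ 0#

    -- The trace of linearity in the first row: its coefficients come from `u` and from rows already
    -- fixed, all constant for the variables of row `ρ i`. Every `i` is included because later rows
    -- become the head once earlier ones are fixed.
    DifferentiatesHead : (Fin m → Fin n) → RowFunction n m → Set (c ⊔ ℓ)
    DifferentiatesHead {zero}  ρ D = ⊤
    DifferentiatesHead {suc m} ρ D = ∀ i j a u → Constant (ρ i) j u →
      ∂ (ρ i) j (D (a ∷ u)) ≈ D ((λ k → ∂ (ρ i) j (a k)) ∷ u)

    det-differentiatesHead : ∀ {m} (κ : Fin m → Fin n) (ρ : Fin m → Fin n) →
      DifferentiatesHead ρ (λ w → det λ r c → w r (κ c))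
    det-differentiatesHead {zero}  κ ρ = tt
    det-differentiatesHead {suc m} κ ρ i j a u u-const = trans (∂.alt-homo (ρ i) j _)
      (alt-cong λ k → ∂.*-constant (ρ i) j
        (∂.det-constant (ρ i) j _ λ r c → u-const r (κ (punchIn k c))))

    -- Exchanging the first two rows puts `a` in front and `X (ρ zero)` into the tail. There it is
    -- constant, since by injectivity of `ρ` its variables belong to a different row.
    differentiatesHead-tail : (ρ : Fin (suc m) → Fin n) → Injective _≡_ _≡_ ρ →
      (D : RowFunction n (suc m)) → Alternating D →
      DifferentiatesHead ρ D → DifferentiatesHead (ρ ∘ suc) (D ∘ (X (ρ zero) ∷_))
    differentiatesHead-tail {zero}  ρ ρ-inj D D-alt D-∂ = tt
    differentiatesHead-tail {suc m} ρ ρ-inj D (D-swap , _) D-∂ i j a u u-const = begin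
      d (D (x ∷ a ∷ u))                  ≈⟨ ∂.cong (ρ (suc i)) j (D-swap x a u) ⟩
      d (- D (a ∷ x ∷ u))                ≈⟨ ∂.-‿homo (ρ (suc i)) j _ ⟩
      - d (D (a ∷ x ∷ u))                ≈⟨ -‿cong (D-∂ (suc i) j a (x ∷ u) λ
                                              { zero → ∂X-other (λ eq → 1+n≢0 (ρ-inj eq)) j
                                              ; (suc r) → u-const r }) ⟩
      - D ((λ k → d (a k)) ∷ x ∷ u)      ≈⟨ D-swap x (λ k → d (a k)) u ⟨
      D (x ∷ (λ k → d (a k)) ∷ u)        ∎
      where
      x = X (ρ zero)
      d = ∂ (ρ (suc i)) j
      1+n≢0 : suc i ≢ zero
      1+n≢0 ()

    ∂δ : ∀ {m} i j (a b : Fin m) → ∂ i j (δ a b) ≈ 0#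
    ∂δ i j zero    zero    = ∂.1-homo i j
    ∂δ i j zero    (suc b) = ∂.0-homo i j
    ∂δ i j (suc a) zero    = ∂.0-homo i j
    ∂δ i j (suc a) (suc b) = ∂δ i j a b

    -- The scalar in ∂(x^t) = (t x^(t-1)) ∂x; it is 0 for t = 0.
    dpow : Carrier → ℕ → Carrier
    dpow x zero    = 0#
    dpow x (suc t) = fromℕ (suc t) * x ^ t

    *-dpow : ∀ x t → x * dpow x t ≈ fromℕ t * x ^ t
    *-dpow x zero    = trans (zeroʳ _) (sym (zeroˡ _))
    *-dpow x (suc t) = x*yz≈y*xz _ _ _

    ∂-pow : ∀ i j x t → ∂ i j (x ^ t) ≈ dpow x t * ∂ i j x
    ∂-pow i j x zero    = trans (∂.1-homo i j) (sym (zeroˡ _))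
    ∂-pow i j x (suc t) = begin
      d (x * x ^ t)                        ≈⟨ ∂.leibniz i j _ _ ⟩
      d x * x ^ t + x * d (x ^ t)          ≈⟨ +-cong (*-comm _ _) (*-congˡ (∂-pow i j x t)) ⟩
      x ^ t * d x + x * (dpow x t * d x)   ≈⟨ +-congˡ (*-assoc _ _ _) ⟨
      x ^ t * d x + x * dpow x t * d x     ≈⟨ distribʳ _ _ _ ⟨
      (x ^ t + x * dpow x t) * d x         ≈⟨ *-congʳ (+-cong (*-identityˡ _) (sym (*-dpow x t))) ⟨
      (1# * x ^ t + fromℕ t * x ^ t) * d x ≈⟨ *-congʳ (distribʳ _ _ _) ⟨
      fromℕ (suc t) * x ^ t * d x          ∎
      where d = ∂ i j

    -- D stands for the determinant with its leading n - m rows fixed to those of X.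
    cayley-minor : ∀ {m} (ρ f : Fin m → Fin n) → Injective _≡_ _≡_ ρ →
      (D : RowFunction n m) → Congruent D → Alternating D → DifferentiatesHead ρ D → Exchange D →
      ∀ {d} → D (X ∘ ρ) ≈ d → ∀ t →
      detOp ρ f (d ^ suc t) ≈ fromℕ (rising t m) * (d ^ t * D (δ ∘ f))
    cayley-minor {zero} ρ f ρ-inj D D-cong D-alt D-∂ D-ex {d} D≈d t = begin
      d * d ^ t                      ≈⟨ *-comm _ _ ⟩
      d ^ t * d                      ≈⟨ *-congˡ (trans (D-cong λ ()) D≈d) ⟨
      d ^ t * D (δ ∘ f)              ≈⟨ *-identityˡ _ ⟨
      1# * (d ^ t * D (δ ∘ f))       ≈⟨ *-congʳ (+-identityʳ 1#) ⟨
      fromℕ 1 * (d ^ t * D (δ ∘ f))  ∎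
    cayley-minor {suc m} ρ f ρ-inj D D-cong D-alt D-∂ D-ex {d} D≈d t = begin
      alt (λ j → ∂′ j (detOp (ρ ∘ suc) (f ∘ punchIn j) (d ^ suc t)))
        ≈⟨ alt-cong (λ j → ∂.cong _ _
             -- Fixing the row `x` of X does not change the value `d`, so the induction hypothesis
             -- concerns the same power.
             (cayley-minor (ρ ∘ suc) (f ∘ punchIn j) (λ eq → suc-injective (ρ-inj eq))
               (D ∘ (x ∷_)) (λ eq → D-cong (∷-cong (λ i → refl) eq))
               (alternating-tail D D-alt x)
               (differentiatesHead-tail ρ ρ-inj D D-alt D-∂)
               (exchange-tail D D-cong D-alt D-ex x) xu≈d t)) ⟩
      alt (λ j → ∂′ j (P * (d ^ t * M j)))
        ≈⟨ alt-cong (λ j → trans (∂.constant-* _ _ (∂.fromℕ-homo _ _ (rising t m))) (*-congˡ (product-rule j))) ⟩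
      alt (λ j → P * (dpow d t * (φ j * M j) + d ^ t * N j))
        ≈⟨ *-alt _ _ ⟨
      P * alt (λ j → dpow d t * (φ j * M j) + d ^ t * N j)
        ≈⟨ *-congˡ (trans (alt-+ _ _) (+-cong (sym (*-alt _ _)) (sym (*-alt _ _)))) ⟩
      P * (dpow d t * alt (λ j → φ j * M j) + d ^ t * alt N)
        -- `φ` and `M` are the two factors of the exchange relation for the rows `δ ∘ f`, while
        -- `N j` has row `j` of `δ ∘ f` moved to the front.
        ≈⟨ *-congˡ (+-cong
             (*-congˡ (trans (exchange-rows D D-cong D-ex x u (δ ∘ f)) (*-congʳ xu≈d)))
             (*-congˡ (alternating-cycle D D-cong D-alt (δ ∘ f)))) ⟩
      P * (dpow d t * (d * E) + d ^ t * (fromℕ (suc m) * E))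
        ≈⟨ *-congˡ (+-cong
             (trans (sym (*-assoc _ _ _)) (trans (*-congʳ (trans (*-comm _ _) (*-dpow d t))) (*-assoc _ _ _)))
             (x*yz≈y*xz _ _ _)) ⟩
      P * (fromℕ t * (d ^ t * E) + fromℕ (suc m) * (d ^ t * E))
        ≈⟨ *-congˡ (distribʳ _ _ _) ⟨
      P * ((fromℕ t + fromℕ (suc m)) * (d ^ t * E))
        ≈⟨ *-assoc _ _ _ ⟨
      P * (fromℕ t + fromℕ (suc m)) * (d ^ t * E)
        ≈⟨ *-congʳ (*-congˡ (×-homo-+ 1# t (suc m))) ⟨
      P * fromℕ (t ℕ.+ suc m) * (d ^ t * E)
        ≈⟨ *-congʳ (×1-homo-* (rising t m) (t ℕ.+ suc m)) ⟨
      fromℕ (rising t (suc m)) * (d ^ t * E) ∎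
      where
      ∂′ = λ j → ∂ (ρ zero) (f j)
      x = X (ρ zero)
      u = X ∘ ρ ∘ suc
      P = fromℕ (rising t m)
      E = D (δ ∘ f)
      φ = λ j → D (δ (f j) ∷ u)
      M = λ j → D (x ∷ (δ ∘ f ∘ punchIn j))
      N = λ j → D (δ (f j) ∷ (δ ∘ f ∘ punchIn j))
      xu≈d : D (x ∷ u) ≈ d
      xu≈d = trans (D-cong (head∷tail (X ∘ ρ))) D≈d
      0≢suc : ∀ {i : Fin m} → suc i ≢ zero
      0≢suc ()
      ∂d : ∀ j → ∂′ j d ≈ φ j
      ∂d j = trans (∂.cong _ _ (sym xu≈d)) (trans
        (D-∂ zero (f j) x u λ r → ∂X-other (λ eq → 0≢suc (≡.sym (ρ-inj eq))) (f j))
        (D-cong (∷-cong (∂X (ρ zero) (f j)) λ r c → refl)))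
      ∂M : ∀ j → ∂′ j (M j) ≈ N j
      ∂M j = trans
        (D-∂ zero (f j) x _ λ r → ∂δ _ _ (f (punchIn j r)))
        (D-cong (∷-cong (∂X (ρ zero) (f j)) λ r c → refl))
      product-rule : ∀ j → ∂′ j (d ^ t * M j) ≈ dpow d t * (φ j * M j) + d ^ t * N j
      product-rule j = trans (∂.leibniz _ _ _ _) (+-cong
        (trans (*-congʳ (trans (∂-pow _ _ d t) (*-congˡ (∂d j)))) (*-assoc _ _ _))
        (*-congˡ (∂M j)))

    cayley : ∀ t → detOp id id (det X ^ suc t) ≈ fromℕ (rising t n) * det X ^ t
    cayley t = begin
      detOp id id (det X ^ suc t)
        ≈⟨ cayley-minor id id id det det-cong (minor-alternating id)
             (det-differentiatesHead id id) (det-exchange n) refl t ⟩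
      fromℕ (rising t n) * (det X ^ t * det (δ {n}))
        ≈⟨ *-congˡ (trans (*-congˡ (det-δ n)) (*-identityʳ _)) ⟩
      fromℕ (rising t n) * det X ^ t ∎

-- Polynomials as term lists and their commutative ring.

open import Defs
open import Data.Bool using (Bool; true; false; if_then_else_; _∧_)
open import Data.Integer using (ℤ; +_) renaming (_+_ to _+ℤ_; _*_ to _*ℤ_; -_ to -ℤ_)
import Data.Integer.Properties as ℤP
open import Data.Integer.Tactic.RingSolver using (solve-∀)
open import Data.List as List using (List; []; _∷_; _++_; concatMap; map)
import Data.List.Properties as ListP
open import Data.List.Relation.Unary.All as All using (All; []; _∷_)
import Data.List.Relation.Unary.All.Properties as AllP
open import Data.Nat using (_≤_; _*_; _+_; _!)
open import Data.Nat.ListAction using (product)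
open import Data.Nat.ListAction.Properties using (product-++)
import Data.Nat.Properties as ℕP
open import Data.Vec as Vec using (Vec; lookup)
import Data.Vec.Properties as VecP
open import Relation.Binary.Definitions using (DecidableEquality)
open import Relation.Binary.PropositionalEquality
  using (refl; cong; cong₂; sym; trans; module ≡-Reasoning)
open import Relation.Nullary using (Dec; yes; no; ¬_)
open import Relation.Nullary.Decidable using (⌊_⌋; isYes≗does; dec-true)

private variable
  n : ℕ

-- The linear extension of `L` from monomials to term lists. It replaces collecting like terms: sums
-- become sums of values and products become iterated evaluations.
⟦_⟧ : Poly n → (Mon n → ℤ) → ℤ
⟦ [] ⟧ L = + 0
⟦ (c , β) ∷ p ⟧ L = c *ℤ L β +ℤ ⟦ p ⟧ L

⟦⟧-cong : ∀ (p : Poly n) {L M} → (∀ β → L β ≡ M β) → ⟦ p ⟧ L ≡ ⟦ p ⟧ M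
⟦⟧-cong [] eq = refl
⟦⟧-cong ((c , β) ∷ p) eq = cong₂ _+ℤ_ (cong (c *ℤ_) (eq β)) (⟦⟧-cong p eq)

⟦⟧-+ : ∀ (p : Poly n) L M → ⟦ p ⟧ (λ β → L β +ℤ M β) ≡ ⟦ p ⟧ L +ℤ ⟦ p ⟧ M
⟦⟧-+ [] L M = refl
⟦⟧-+ ((c , β) ∷ p) L M rewrite ⟦⟧-+ p L M = lemma c (L β) (M β) (⟦ p ⟧ L) (⟦ p ⟧ M)
  where
  lemma : ∀ c x y u v → c *ℤ (x +ℤ y) +ℤ (u +ℤ v) ≡ (c *ℤ x +ℤ u) +ℤ (c *ℤ y +ℤ v)
  lemma = solve-∀

⟦⟧-* : ∀ (p : Poly n) a L → ⟦ p ⟧ (λ β → a *ℤ L β) ≡ a *ℤ ⟦ p ⟧ L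
⟦⟧-* [] a L = sym (ℤP.*-zeroʳ a)
⟦⟧-* ((c , β) ∷ p) a L rewrite ⟦⟧-* p a L = lemma c a (L β) (⟦ p ⟧ L)
  where
  lemma : ∀ c a x u → c *ℤ (a *ℤ x) +ℤ a *ℤ u ≡ a *ℤ (c *ℤ x +ℤ u)
  lemma = solve-∀

⟦⟧-0 : ∀ (p : Poly n) {L} → (∀ β → L β ≡ + 0) → ⟦ p ⟧ L ≡ + 0
⟦⟧-0 [] eq = refl
⟦⟧-0 ((c , β) ∷ p) eq = cong₂ _+ℤ_ (trans (cong (c *ℤ_) (eq β)) (ℤP.*-zeroʳ c)) (⟦⟧-0 p eq)

⟦⟧-swap : ∀ (p q : Poly n) (F : Mon n → Mon n → ℤ) →
          ⟦ p ⟧ (λ β → ⟦ q ⟧ (F β)) ≡ ⟦ q ⟧ (λ γ → ⟦ p ⟧ (λ β → F β γ))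
⟦⟧-swap [] q F = sym (⟦⟧-0 q λ _ → refl)
⟦⟧-swap ((c , β) ∷ p) q F =
  trans (cong₂ _+ℤ_ (sym (⟦⟧-* q c (F β))) (⟦⟧-swap p q F)) (sym (⟦⟧-+ q _ _))

⟦++⟧ : ∀ (p q : Poly n) L → ⟦ p ++ q ⟧ L ≡ ⟦ p ⟧ L +ℤ ⟦ q ⟧ L
⟦++⟧ [] q L = sym (ℤP.+-identityˡ _)
⟦++⟧ ((c , β) ∷ p) q L rewrite ⟦++⟧ p q L = sym (ℤP.+-assoc (c *ℤ L β) (⟦ p ⟧ L) (⟦ q ⟧ L))

⟦map⟧ : ∀ (h : ℤ × Mon n → ℤ × Mon n) {L M} →
        (∀ c β → proj₁ (h (c , β)) *ℤ L (proj₂ (h (c , β))) ≡ c *ℤ M β) →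
        ∀ p → ⟦ List.map h p ⟧ L ≡ ⟦ p ⟧ M
⟦map⟧ h eq [] = refl
⟦map⟧ h eq ((c , β) ∷ p) = cong₂ _+ℤ_ (eq c β) (⟦map⟧ h eq p)

⟦concatMap⟧ : ∀ (h : ℤ × Mon n → Poly n) {L M} → (∀ c β → ⟦ h (c , β) ⟧ L ≡ c *ℤ M β) →
              ∀ p → ⟦ concatMap h p ⟧ L ≡ ⟦ p ⟧ M
⟦concatMap⟧ h eq [] = refl
⟦concatMap⟧ h eq ((c , β) ∷ p) = trans (⟦++⟧ (h (c , β)) _ _) (cong₂ _+ℤ_ (eq c β) (⟦concatMap⟧ h eq p))

⟦scaleP⟧ : ∀ a (p : Poly n) L → ⟦ scaleP a p ⟧ L ≡ a *ℤ ⟦ p ⟧ L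
⟦scaleP⟧ a p L = trans (⟦map⟧ _ (λ c β → lemma a c (L β)) p) (⟦⟧-* p a L)
  where
  lemma : ∀ a c x → (a *ℤ c) *ℤ x ≡ c *ℤ (a *ℤ x)
  lemma = solve-∀

⟦⊗⟧ : ∀ (p q : Poly n) L → ⟦ p ⊗ q ⟧ L ≡ ⟦ p ⟧ (λ β → ⟦ q ⟧ (λ γ → L (addM β γ)))
⟦⊗⟧ p q L = ⟦concatMap⟧ _ (λ c β → trans
  (⟦map⟧ _ (λ d γ → lemma c d (L (addM β γ))) q) (⟦⟧-* q c λ γ → L (addM β γ))) p
  where
  lemma : ∀ c d x → (c *ℤ d) *ℤ x ≡ d *ℤ (c *ℤ x)
  lemma = solve-∀

addM-comm : ∀ (α β : Mon n) → addM α β ≡ addM β α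
addM-comm = VecP.zipWith-comm (VecP.zipWith-comm ℕP.+-comm)

addM-assoc : ∀ (α β γ : Mon n) → addM (addM α β) γ ≡ addM α (addM β γ)
addM-assoc = VecP.zipWith-assoc (VecP.zipWith-assoc ℕP.+-assoc)

addM-identityˡ : ∀ (α : Mon n) → addM zeroM α ≡ α
addM-identityˡ = VecP.zipWith-identityˡ (VecP.zipWith-identityˡ ℕP.+-identityˡ)

-- Equality of polynomials tested against all linear functionals L on
-- monomials; the coefficient functionals among them give equality of coefficients.
infix 4 _≈ₚ_
record _≈ₚ_ {n} (p q : Poly n) : Set where
  constructor mk
  field ev : ∀ L → ⟦ p ⟧ L ≡ ⟦ q ⟧ L
open _≈ₚ_

-ₚ_ : Poly n → Poly n
-ₚ_ = scaleP (-ℤ + 1)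

⊗-comm : ∀ (p q : Poly n) → p ⊗ q ≈ₚ q ⊗ p
⊗-comm p q .ev L = trans (⟦⊗⟧ p q L) (trans (⟦⟧-swap p q _) (trans
  (⟦⟧-cong q λ γ → ⟦⟧-cong p λ β → cong L (addM-comm β γ)) (sym (⟦⊗⟧ q p L))))

⊗-cong : {p p′ q q′ : Poly n} → p ≈ₚ p′ → q ≈ₚ q′ → p ⊗ q ≈ₚ p′ ⊗ q′
⊗-cong {p = p} {p′} {q} {q′} eq eq′ .ev L = trans (⟦⊗⟧ p q L) (trans (ev eq _)
  (trans (⟦⟧-cong p′ λ β → ev eq′ _) (sym (⟦⊗⟧ p′ q′ L))))

⊗-assoc : ∀ (p q r : Poly n) → (p ⊗ q) ⊗ r ≈ₚ p ⊗ (q ⊗ r)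
⊗-assoc p q r .ev L = begin
  ⟦ (p ⊗ q) ⊗ r ⟧ L
    ≡⟨ trans (⟦⊗⟧ (p ⊗ q) r L) (⟦⊗⟧ p q _) ⟩
  ⟦ p ⟧ (λ α → ⟦ q ⟧ λ β → ⟦ r ⟧ λ γ → L (addM (addM α β) γ))
    ≡⟨ ⟦⟧-cong p (λ α → ⟦⟧-cong q λ β → ⟦⟧-cong r λ γ → cong L (addM-assoc α β γ)) ⟩
  ⟦ p ⟧ (λ α → ⟦ q ⟧ λ β → ⟦ r ⟧ λ γ → L (addM α (addM β γ)))
    ≡⟨ trans (⟦⊗⟧ p (q ⊗ r) L) (⟦⟧-cong p λ α → ⟦⊗⟧ q r _) ⟨
  ⟦ p ⊗ (q ⊗ r) ⟧ L ∎
  where open ≡-Reasoning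

⟦oneP⟧ : ∀ (L : Mon n → ℤ) → ⟦ oneP ⟧ L ≡ L zeroM
⟦oneP⟧ L = trans (ℤP.+-identityʳ _) (ℤP.*-identityˡ _)

⊗-identityˡ : ∀ (p : Poly n) → oneP ⊗ p ≈ₚ p
⊗-identityˡ p .ev L = trans (⟦⊗⟧ oneP p L) (trans (⟦oneP⟧ {_} (λ β → ⟦ p ⟧ (λ γ → L (addM β γ))))
  (⟦⟧-cong p λ γ → cong L (addM-identityˡ γ)))

⊗-distribˡ : ∀ (p q r : Poly n) → p ⊗ (q ++ r) ≈ₚ (p ⊗ q) ++ (p ⊗ r)
⊗-distribˡ p q r .ev L = trans (⟦⊗⟧ p (q ++ r) L) (trans (⟦⟧-cong p λ β → ⟦++⟧ q r _)
  (trans (⟦⟧-+ p _ _) (sym (trans (⟦++⟧ (p ⊗ q) (p ⊗ r) L) (cong₂ _+ℤ_ (⟦⊗⟧ p q L) (⟦⊗⟧ p r L))))))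

++-comm : ∀ (p q : Poly n) → p ++ q ≈ₚ q ++ p
++-comm p q .ev L = trans (⟦++⟧ p q L) (trans (ℤP.+-comm (⟦ p ⟧ L) (⟦ q ⟧ L)) (sym (⟦++⟧ q p L)))

-ₚ-inverseˡ : ∀ (p : Poly n) → (-ₚ p) ++ p ≈ₚ []
-ₚ-inverseˡ p .ev L = trans (⟦++⟧ (-ₚ p) p L) (trans (cong (_+ℤ ⟦ p ⟧ L) (⟦scaleP⟧ (-ℤ + 1) p L)) (lemma (⟦ p ⟧ L)))
  where
  lemma : ∀ x → (-ℤ + 1) *ℤ x +ℤ x ≡ + 0
  lemma = solve-∀

polyRing : ℕ → CommutativeRing _ _
polyRing n = record
  { Carrier = Poly n
  ; _≈_ = _≈ₚ_
  ; _+_ = _++_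
  ; _*_ = _⊗_
  ; -_ = -ₚ_
  ; 0# = []
  ; 1# = oneP
  ; isCommutativeRing = record
    { isRing = record
      { +-isAbelianGroup = record
        { isGroup = record
          { isMonoid = record
            { isSemigroup = record
              { isMagma = record
                { isEquivalence = ≈-equiv
                ; ∙-cong = λ {p} {p′} {q} {q′} eq eq′ → mk λ L →
                    trans (⟦++⟧ p q L) (trans (cong₂ _+ℤ_ (ev eq L) (ev eq′ L)) (sym (⟦++⟧ p′ q′ L)))
                }
              ; assoc = λ p q r → mk λ L → cong (λ s → ⟦ s ⟧ L) (++-assoc p q r)
              }
            ; identity = (λ p → mk λ L → refl) , (λ p → mk λ L → cong (λ s → ⟦ s ⟧ L) (++-identityʳ p))
            }
          ; inverse = -ₚ-inverseˡ , (λ p → ≈-trans (++-comm p (-ₚ p)) (-ₚ-inverseˡ p))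
          ; ⁻¹-cong = λ {p} {q} eq → mk λ L →
              trans (⟦scaleP⟧ (-ℤ + 1) p L) (trans (cong ((-ℤ + 1) *ℤ_) (ev eq L)) (sym (⟦scaleP⟧ (-ℤ + 1) q L)))
          }
        ; comm = ++-comm
        }
      ; *-cong = ⊗-cong
      ; *-assoc = ⊗-assoc
      ; *-identity = ⊗-identityˡ , (λ p → ≈-trans (⊗-comm p oneP) (⊗-identityˡ p))
      ; distrib = ⊗-distribˡ , λ p q r → mk λ L → trans (ev (⊗-comm (q ++ r) p) L) (trans (ev (⊗-distribˡ p q r) L)
          (trans (⟦++⟧ (p ⊗ q) (p ⊗ r) L) (trans (cong₂ _+ℤ_ (ev (⊗-comm p q) L) (ev (⊗-comm p r) L))
            (sym (⟦++⟧ (q ⊗ p) (r ⊗ p) L)))))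
      }
    ; *-comm = ⊗-comm
    }
  }
  where
  open import Data.List.Properties using (++-assoc; ++-identityʳ)
  open import Relation.Binary.Structures using (IsEquivalence)
  ≈-trans : ∀ {p q r : Poly n} → p ≈ₚ q → q ≈ₚ r → p ≈ₚ r
  ≈-trans e f = mk λ L → trans (ev e L) (ev f L)
  ≈-equiv : IsEquivalence (_≈ₚ_ {n})
  ≈-equiv = record { refl = mk λ L → refl ; sym = λ e → mk λ L → sym (ev e L) ; trans = ≈-trans }

-- Exponents and partial derivatives.

at : Fin n → Fin n → Mon n → ℕ
at i j β = lookup (lookup β i) j

Mon-ext : {β γ : Mon n} → (∀ a b → at a b β ≡ at a b γ) → β ≡ γ
Mon-ext eq = lookup-ext λ a → lookup-ext λ b → eq a b
  where
  lookup-ext : ∀ {A : Set} {m} {u v : Vec A m} → (∀ i → lookup u i ≡ lookup v i) → u ≡ v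
  lookup-ext {u = u} {v} eq = trans (sym (VecP.tabulate∘lookup u)) (trans (VecP.tabulate-cong eq) (VecP.tabulate∘lookup v))

at-zipWith : ∀ (f : ℕ → ℕ → ℕ) a b (β γ : Mon n) →
             at a b (Vec.zipWith (Vec.zipWith f) β γ) ≡ f (at a b β) (at a b γ)
at-zipWith f a b β γ = trans
  (cong (λ r → lookup r b) (VecP.lookup-zipWith (Vec.zipWith f) a β γ))
  (VecP.lookup-zipWith f b (lookup β a) (lookup γ a))

at-addM : ∀ a b (β γ : Mon n) → at a b (addM β γ) ≡ at a b β ℕ.+ at a b γ
at-addM = at-zipWith ℕ._+_

at-zeroM : ∀ a b → at {n} a b zeroM ≡ 0
at-zeroM {n} a b = trans (cong (λ r → lookup r b) (VecP.lookup-replicate a (Vec.replicate n 0))) (VecP.lookup-replicate b 0)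

at-unitM : ∀ (a b i j : Fin n) → at a b (unitM i j) ≡ (if ⌊ a ≟F i ⌋ ∧ ⌊ b ≟F j ⌋ then 1 else 0)
at-unitM a b i j = trans (cong (λ r → lookup r b) (VecP.lookup∘tabulate _ a)) (VecP.lookup∘tabulate _ b)

at-unitM-same : ∀ (i j : Fin n) → at i j (unitM i j) ≡ 1
at-unitM-same i j with i ≟F i | j ≟F j | at-unitM i j i j
... | yes _ | yes _ | eq = eq
... | no i≢i | _ | _ = ⊥-elim (i≢i refl)
... | yes _ | no j≢j | _ = ⊥-elim (j≢j refl)

at-unitM-other : ∀ (a b i j : Fin n) → ¬ (a ≡ i × b ≡ j) → at a b (unitM i j) ≡ 0
at-unitM-other a b i j ne with a ≟F i | b ≟F j | at-unitM a b i j
... | yes p | yes q | _ = ⊥-elim (ne (p , q))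
... | yes _ | no _ | eq = eq
... | no _ | _ | eq = eq

-- Subtraction is truncated at exponent 0, but `∂ₚ` attaches the coefficient 0 to exactly that case.
lower : Fin n → Fin n → Mon n → Mon n
lower i j β = Vec.zipWith (Vec.zipWith ℕ._∸_) β (unitM i j)

at-lower : ∀ a b (i j : Fin n) β → at a b (lower i j β) ≡ at a b β ℕ.∸ at a b (unitM i j)
at-lower a b i j β = at-zipWith ℕ._∸_ a b β (unitM i j)

unitM-≤ : ∀ (i j : Fin n) (β : Mon n) {k} → at i j β ≡ suc k → ∀ a b → at a b (unitM i j) ℕ.≤ at a b β
unitM-≤ i j β eq a b with a ≟F i | b ≟F j
... | yes refl | yes refl rewrite at-unitM-same i j | eq = ℕ.s≤s ℕ.z≤n
... | no a≢i | _ rewrite at-unitM-other a b i j (λ p → a≢i (proj₁ p)) = ℕ.z≤n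
... | yes _ | no b≢j rewrite at-unitM-other a b i j (λ p → b≢j (proj₂ p)) = ℕ.z≤n

lower-addM : ∀ (i j : Fin n) (β γ : Mon n) {k} → at i j β ≡ suc k →
             lower i j (addM β γ) ≡ addM (lower i j β) γ
lower-addM i j β γ eq = Mon-ext λ a b → begin
  at a b (lower i j (addM β γ))
    ≡⟨ at-lower a b i j (addM β γ) ⟩
  at a b (addM β γ) ℕ.∸ at a b (unitM i j)
    ≡⟨ cong (ℕ._∸ at a b (unitM i j)) (at-addM a b β γ) ⟩
  (at a b β ℕ.+ at a b γ) ℕ.∸ at a b (unitM i j)
    ≡⟨ ℕP.+-∸-comm (at a b γ) (unitM-≤ i j β eq a b) ⟩
  (at a b β ℕ.∸ at a b (unitM i j)) ℕ.+ at a b γ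
    ≡⟨ cong (ℕ._+ at a b γ) (at-lower a b i j β) ⟨
  at a b (lower i j β) ℕ.+ at a b γ
    ≡⟨ at-addM a b (lower i j β) γ ⟨
  at a b (addM (lower i j β) γ) ∎
  where open ≡-Reasoning

lower-unitM : ∀ (i j : Fin n) → lower i j (unitM i j) ≡ zeroM
lower-unitM i j = Mon-ext λ a b → trans (at-lower a b i j (unitM i j))
  (trans (ℕP.n∸n≡0 (at a b (unitM i j))) (sym (at-zeroM a b)))

lower-raise : ∀ (i j : Fin n) (β : Mon n) → lower i j (addM (unitM i j) β) ≡ β
lower-raise i j β = trans (lower-addM i j (unitM i j) β (at-unitM-same i j))
  (trans (cong (λ γ → addM γ β) (lower-unitM i j)) (addM-identityˡ β))

raise-lower : ∀ (i j : Fin n) (γ : Mon n) {k} → at i j γ ≡ suc k → addM (unitM i j) (lower i j γ) ≡ γ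
raise-lower i j γ eq = Mon-ext λ a b → trans (at-addM a b (unitM i j) (lower i j γ))
  (trans (cong (at a b (unitM i j) ℕ.+_) (at-lower a b i j γ)) (ℕP.m+[n∸m]≡n (unitM-≤ i j γ eq a b)))

∂ₚ : Fin n → Fin n → Poly n → Poly n
∂ₚ i j = List.map λ t → proj₁ t *ℤ + at i j (proj₂ t) , lower i j (proj₂ t)

⟦∂ₚ⟧ : ∀ (i j : Fin n) p L → ⟦ ∂ₚ i j p ⟧ L ≡ ⟦ p ⟧ (λ β → + at i j β *ℤ L (lower i j β))
⟦∂ₚ⟧ i j p L = ⟦map⟧ _ (λ c β → ℤP.*-assoc c _ _) p

private module R n = CommutativeRing (polyRing n)
private module D n = Determinant (polyRing n)

∂ₚ-derivation : ∀ (i j : Fin n) → D.IsDerivation n (∂ₚ i j)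
∂ₚ-derivation i j = record
  { cong = λ {p} {q} eq → mk λ L → trans (⟦∂ₚ⟧ i j p L) (trans (ev eq _) (sym (⟦∂ₚ⟧ i j q L)))
  ; +-homo = λ p q → mk λ L → cong (λ r → ⟦ r ⟧ L) (ListP.map-++ _ p q)
  ; leibniz = λ p q → mk λ L → begin
      ⟦ ∂ₚ i j (p ⊗ q) ⟧ L
        ≡⟨ trans (⟦∂ₚ⟧ i j (p ⊗ q) L) (⟦⊗⟧ p q _) ⟩
      ⟦ p ⟧ (λ β → ⟦ q ⟧ λ γ → + at i j (addM β γ) *ℤ L (lower i j (addM β γ)))
        ≡⟨ ⟦⟧-cong p (λ β → trans (⟦⟧-cong q (pointwise L β)) (⟦⟧-+ q _ _)) ⟩
      ⟦ p ⟧ (λ β → ⟦ q ⟧ (λ γ → + at i j β *ℤ L (addM (lower i j β) γ))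
                 +ℤ ⟦ q ⟧ (λ γ → + at i j γ *ℤ L (addM β (lower i j γ))))
        ≡⟨ ⟦⟧-+ p _ _ ⟩
      ⟦ p ⟧ (λ β → ⟦ q ⟧ (λ γ → + at i j β *ℤ L (addM (lower i j β) γ))) +ℤ
      ⟦ p ⟧ (λ β → ⟦ q ⟧ (λ γ → + at i j γ *ℤ L (addM β (lower i j γ))))
        ≡⟨ cong₂ _+ℤ_
             (trans (⟦⊗⟧ (∂ₚ i j p) q L) (trans (⟦∂ₚ⟧ i j p _) (⟦⟧-cong p λ β → 
               sym (⟦⟧-* q (+ at i j β) λ γ → L (addM (lower i j β) γ)))))
             (trans (⟦⊗⟧ p (∂ₚ i j q) L) (⟦⟧-cong p λ β → ⟦∂ₚ⟧ i j q _)) ⟨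
      ⟦ ∂ₚ i j p ⊗ q ⟧ L +ℤ ⟦ p ⊗ ∂ₚ i j q ⟧ L
        ≡⟨ ⟦++⟧ (∂ₚ i j p ⊗ q) (p ⊗ ∂ₚ i j q) L ⟨
      ⟦ (∂ₚ i j p ⊗ q) ++ (p ⊗ ∂ₚ i j q) ⟧ L ∎
  }
  where
  open ≡-Reasoning
  -- At exponent 0 the coefficient kills both sides; otherwise the lowering can be carried out
  -- within `β` alone.
  left : ∀ (L : Mon _ → ℤ) β γ →
         + at i j β *ℤ L (lower i j (addM β γ)) ≡ + at i j β *ℤ L (addM (lower i j β) γ)
  left L β γ with at i j β in eq
  ... | zero  = refl
  ... | suc k = cong (λ α → + suc k *ℤ L α) (lower-addM i j β γ eq)
  right : ∀ (L : Mon _ → ℤ) β γ →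
          + at i j γ *ℤ L (lower i j (addM β γ)) ≡ + at i j γ *ℤ L (addM β (lower i j γ))
  right L β γ = trans (cong (λ α → + at i j γ *ℤ L (lower i j α)) (addM-comm β γ))
    (trans (left L γ β) (cong (λ α → + at i j γ *ℤ L α) (addM-comm (lower i j γ) β)))
  pointwise : ∀ (L : Mon _ → ℤ) β γ → + at i j (addM β γ) *ℤ L (lower i j (addM β γ)) ≡
    + at i j β *ℤ L (addM (lower i j β) γ) +ℤ + at i j γ *ℤ L (addM β (lower i j γ))
  pointwise L β γ = begin
    + at i j (addM β γ) *ℤ x
      ≡⟨ cong (λ k → + k *ℤ x) (at-addM i j β γ) ⟩
    + (at i j β ℕ.+ at i j γ) *ℤ x
      ≡⟨ cong (_*ℤ x) (ℤP.pos-+ (at i j β) (at i j γ)) ⟩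
    (+ at i j β +ℤ + at i j γ) *ℤ x
      ≡⟨ ℤP.*-distribʳ-+ x (+ at i j β) (+ at i j γ) ⟩
    + at i j β *ℤ x +ℤ + at i j γ *ℤ x
      ≡⟨ cong₂ _+ℤ_ (left L β γ) (right L β γ) ⟩
    + at i j β *ℤ L (addM (lower i j β) γ) +ℤ + at i j γ *ℤ L (addM β (lower i j γ)) ∎
    where x = L (lower i j (addM β γ))

⟦varP⟧ : ∀ (i j : Fin n) L → ⟦ varP i j ⟧ L ≡ L (unitM i j)
⟦varP⟧ i j L = trans (ℤP.+-identityʳ _) (ℤP.*-identityˡ _)

∂ₚ-varP-other : ∀ (a b i j : Fin n) → ¬ (a ≡ i × b ≡ j) → ∂ₚ a b (varP i j) ≈ₚ []
∂ₚ-varP-other a b i j ne .ev L = trans (⟦∂ₚ⟧ a b (varP i j) L)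
  (trans (⟦varP⟧ i j (λ β → + at a b β *ℤ L (lower a b β))) (cong (λ k → + k *ℤ L (lower a b (unitM i j))) (at-unitM-other a b i j ne)))

∂ₚ-varP-same : ∀ (i j : Fin n) → ∂ₚ i j (varP i j) ≈ₚ oneP
∂ₚ-varP-same i j .ev L = trans (⟦∂ₚ⟧ i j (varP i j) L)
  (trans (⟦varP⟧ i j (λ β → + at i j β *ℤ L (lower i j β)))
  (trans (cong₂ (λ k β → + k *ℤ L β) (at-unitM-same i j) (lower-unitM i j))
  (sym (ℤP.+-identityʳ _))))

∂ₚ-varP : ∀ (i j l : Fin n) → ∂ₚ i j (varP i l) ≈ₚ D.δ n j l
∂ₚ-varP {n} i j l with j ≟F l
... | yes refl = R.trans n (∂ₚ-varP-same i j) (R.reflexive n (sym (D.δ-refl n j)))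
... | no j≢l = R.trans n (∂ₚ-varP-other i j i l (λ p → j≢l (proj₂ p))) (R.reflexive n (sym (D.δ-≢ n j≢l)))

∂ₚ-varP-row : ∀ {i k : Fin n} → ¬ i ≡ k → ∀ j l → ∂ₚ i j (varP k l) ≈ₚ []
∂ₚ-varP-row i≢k j l = ∂ₚ-varP-other _ j _ l (i≢k ∘ proj₁)

private module C n = D.Cayley n varP ∂ₚ ∂ₚ-derivation ∂ₚ-varP ∂ₚ-varP-row

-- The Fischer pairing and adjoints.

ind : Mon n → Mon n → ℤ
ind α β = if ⌊ α ≟M β ⌋ then + 1 else + 0

⟪_,_⟫ : Poly n → Poly n → ℤ
⟪ p , q ⟫ = ⟦ p ⟧ λ β → ⟦ q ⟧ λ γ → ind β γ *ℤ + factM β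

⟪⟫-cong : {p p′ q q′ : Poly n} → p ≈ₚ p′ → q ≈ₚ q′ → ⟪ p , q ⟫ ≡ ⟪ p′ , q′ ⟫
⟪⟫-cong {p′ = p′} eq eq′ = trans (ev eq _) (⟦⟧-cong p′ λ β → ev eq′ _)

-- `factM` nests two products, so this is applied twice: to the entries of a row and to the rows.
map-updateAt-product : ∀ {A : Set} {m} (g : A → ℕ) (h : A → A) k (v : Vec A m) i →
  g (h (lookup v i)) ≡ k ℕ.* g (lookup v i) →
  product (Vec.toList (Vec.map g (Vec.updateAt v i h))) ≡ k ℕ.* product (Vec.toList (Vec.map g v))
map-updateAt-product g h k (x Vec.∷ v) zero eq rewrite eq = ℕP.*-assoc k (g x) _
map-updateAt-product g h k (x Vec.∷ v) (suc i) eq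
  rewrite map-updateAt-product g h k v i eq = x∙yz≈y∙xz (g x) k _
  where open import Algebra.Properties.CommutativeSemigroup ℕP.*-commutativeSemigroup

-- Multiplication by X_ij as a change of a single entry, which exposes the one factor of `factM`
-- that changes.
raise : Fin n → Fin n → Mon n → Mon n
raise i j β = Vec.updateAt β i λ r → Vec.updateAt r j suc

addM-unitM : ∀ (i j : Fin n) β → addM (unitM i j) β ≡ raise i j β
addM-unitM i j β = Mon-ext λ a b → trans (at-addM a b (unitM i j) β) (entry a b)
  where
  entry : ∀ a b → at a b (unitM i j) ℕ.+ at a b β ≡ at a b (raise i j β)
  entry a b with a ≟F i
  ... | no a≢i rewrite at-unitM-other a b i j (λ p → a≢i (proj₁ p))
    | VecP.lookup∘updateAt′ a i {λ r → Vec.updateAt r j suc} a≢i β = refl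
  ... | yes refl rewrite VecP.lookup∘updateAt i {λ r → Vec.updateAt r j suc} β with b ≟F j
  ...   | yes refl rewrite at-unitM-same i j | VecP.lookup∘updateAt j {suc} (lookup β i) = refl
  ...   | no b≢j rewrite at-unitM-other i b i j (λ p → b≢j (proj₂ p))
    | VecP.lookup∘updateAt′ b j {suc} b≢j (lookup β i) = refl

factM-raise : ∀ (i j : Fin n) β → factM (addM (unitM i j) β) ≡ suc (at i j β) ℕ.* factM β
factM-raise i j β rewrite addM-unitM i j β = map-updateAt-product _ _ (suc (at i j β)) β i
  (map-updateAt-product _! suc (suc (at i j β)) (lookup β i) j refl)

ind-refl : ∀ (β : Mon n) → ind β β ≡ + 1
ind-refl β with β ≟M β
... | yes _ = refl
... | no ne = ⊥-elim (ne refl)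

ind-≢ : {β γ : Mon n} → ¬ β ≡ γ → ind β γ ≡ + 0
ind-≢ {β = β} {γ} ne with β ≟M γ
... | yes eq = ⊥-elim (ne eq)
... | no _ = refl

-- For monomials X^β and X^γ both sides vanish unless γ = β + e_ij, and then (β + e_ij)! = (β_ij +
-- 1) β! = γ_ij β!.
varP-adjoint : ∀ (i j : Fin n) p q → ⟪ varP i j ⊗ p , q ⟫ ≡ ⟪ p , ∂ₚ i j q ⟫
varP-adjoint i j p q = begin
  ⟪ varP i j ⊗ p , q ⟫
    ≡⟨ trans (⟦⊗⟧ (varP i j) p _) 
         (⟦varP⟧ i j (λ α → ⟦ p ⟧ λ β → ⟦ q ⟧ λ γ → ind (addM α β) γ *ℤ + factM (addM α β))) ⟩
  ⟦ p ⟧ (λ β → ⟦ q ⟧ λ γ → ind (addM (unitM i j) β) γ *ℤ + factM (addM (unitM i j) β))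
    ≡⟨ ⟦⟧-cong p (λ β → trans (⟦⟧-cong q (pointwise β)) (sym (⟦∂ₚ⟧ i j q _))) ⟩
  ⟪ p , ∂ₚ i j q ⟫ ∎
  where
  open ≡-Reasoning
  pointwise : ∀ β γ → ind (addM (unitM i j) β) γ *ℤ + factM (addM (unitM i j) β) ≡
                      + at i j γ *ℤ (ind β (lower i j γ) *ℤ + factM β)
  pointwise β γ with addM (unitM i j) β ≟M γ
  ... | yes refl = begin
    + 1 *ℤ + factM (addM (unitM i j) β)
      ≡⟨ ℤP.*-identityˡ _ ⟩
    + factM (addM (unitM i j) β)
      ≡⟨ cong +_ (factM-raise i j β) ⟩
    + (suc (at i j β) ℕ.* factM β)
      ≡⟨ ℤP.pos-* (suc (at i j β)) (factM β) ⟩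
    + suc (at i j β) *ℤ + factM β
      ≡⟨ cong₂ (λ k x → + k *ℤ x)
           (sym (trans (at-addM i j (unitM i j) β) (cong (ℕ._+ at i j β) (at-unitM-same i j))))
           (sym (trans (cong (_*ℤ + factM β) (trans (cong (ind β) (lower-raise i j β)) (ind-refl β)))
                       (ℤP.*-identityˡ (+ factM β)))) ⟩
    + at i j (addM (unitM i j) β) *ℤ (ind β (lower i j (addM (unitM i j) β)) *ℤ + factM β) ∎
  -- Either γ_ij = 0 and the derivative vanishes, or γ lowers to a monomial other than β, because
  -- raising it again recovers γ.
  ... | no ne with at i j γ in eq
  ...   | zero = refl
  ...   | suc k = sym (trans (cong (λ x → + suc k *ℤ (x *ℤ + factM β))
            (ind-≢ {β = β} {lower i j γ} λ { refl → ne (raise-lower i j γ eq) }))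
            (ℤP.*-zeroʳ (+ suc k)))

⟦-⟧ : ∀ (p q : Poly n) L → ⟦ p ++ (-ₚ q) ⟧ L ≡ ⟦ p ⟧ L +ℤ (-ℤ + 1) *ℤ ⟦ q ⟧ L
⟦-⟧ p q L = trans (⟦++⟧ p (-ₚ q) L) (cong (⟦ p ⟧ L +ℤ_) (⟦scaleP⟧ (-ℤ + 1) q L))

alt-adjoint : ∀ {m} (g h : Fin m → Poly n) p q → (∀ j → ⟪ g j ⊗ p , q ⟫ ≡ ⟪ p , h j ⟫) →
              ⟪ D.alt n g ⊗ p , q ⟫ ≡ ⟪ p , D.alt n h ⟫
alt-adjoint {n} {zero} g h p q eq = trans
  (⟪⟫-cong {q = q} (⊗-cong (D.alt-zero n g) (R.refl n {p})) (R.refl n))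
  (sym (trans (⟪⟫-cong {p = p} (R.refl n) (D.alt-zero n h)) (⟦⟧-0 p λ β → refl)))
alt-adjoint {n} {suc m} g h p q eq = begin
  ⟪ D.alt n g ⊗ p , q ⟫
    ≡⟨ ⟪⟫-cong {q = q} (⊗-cong (D.alt-suc n g) (R.refl n {p})) (R.refl n) ⟩
  ⟪ (g zero ++ (-ₚ g′)) ⊗ p , q ⟫
    ≡⟨ trans (⟦⊗⟧ (g zero ++ (-ₚ g′)) p _) (⟦-⟧ (g zero) g′ _) ⟩
  ⟦ g zero ⟧ _ +ℤ (-ℤ + 1) *ℤ ⟦ g′ ⟧ _
    ≡⟨ cong₂ (λ x y → x +ℤ (-ℤ + 1) *ℤ y) (⟦⊗⟧ (g zero) p _) (⟦⊗⟧ g′ p _) ⟨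
  ⟪ g zero ⊗ p , q ⟫ +ℤ (-ℤ + 1) *ℤ ⟪ g′ ⊗ p , q ⟫
    ≡⟨ cong₂ (λ x y → x +ℤ (-ℤ + 1) *ℤ y) (eq zero) (alt-adjoint (g ∘ suc) (h ∘ suc) p q (eq ∘ suc)) ⟩
  ⟪ p , h zero ⟫ +ℤ (-ℤ + 1) *ℤ ⟪ p , h′ ⟫
    ≡⟨ trans (⟦⟧-+ p _ _) (cong (⟪ p , h zero ⟫ +ℤ_) (⟦⟧-* p (-ℤ + 1) _)) ⟨
  ⟦ p ⟧ (λ β → ⟦ h zero ⟧ _ +ℤ (-ℤ + 1) *ℤ ⟦ h′ ⟧ _)
    ≡⟨ ⟦⟧-cong p (λ β → ⟦-⟧ (h zero) h′ _) ⟨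
  ⟪ p , h zero ++ (-ₚ h′) ⟫
    ≡⟨ ⟪⟫-cong {p = p} (R.refl n) (D.alt-suc n h) ⟨
  ⟪ p , D.alt n h ⟫ ∎
  where
  open ≡-Reasoning
  g′ = D.alt n (g ∘ suc)
  h′ = D.alt n (h ∘ suc)

-- Taking adjoints reverses the order of factors. Each entry is therefore first moved past its
-- cofactor, so that its derivative acts last, as in `detOp`.
det-adjoint : ∀ {m} (ρ f : Fin m → Fin n) p q →
  ⟪ D.det n (λ r c → varP (ρ r) (f c)) ⊗ p , q ⟫ ≡ ⟪ p , C.detOp n ρ f q ⟫
det-adjoint {n} {zero} ρ f p q = ⟪⟫-cong {q = q} (⊗-identityˡ p) (R.refl n)
det-adjoint {n} {suc m} ρ f p q = alt-adjoint _ _ p q λ j → begin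
  ⟪ (v j ⊗ M j) ⊗ p , q ⟫
    ≡⟨ ⟪⟫-cong {q = q} (R.trans n (⊗-cong (⊗-comm (v j) (M j)) (R.refl n {p})) (⊗-assoc (M j) (v j) p)) (R.refl n) ⟩
  ⟪ M j ⊗ (v j ⊗ p) , q ⟫
    ≡⟨ det-adjoint (ρ ∘ suc) (f ∘ punchIn j) (v j ⊗ p) q ⟩
  ⟪ v j ⊗ p , C.detOp n (ρ ∘ suc) (f ∘ punchIn j) q ⟫
    ≡⟨ varP-adjoint (ρ zero) (f j) p (C.detOp n (ρ ∘ suc) (f ∘ punchIn j) q) ⟩
  ⟪ p , ∂ₚ (ρ zero) (f j) (C.detOp n (ρ ∘ suc) (f ∘ punchIn j) q) ⟫ ∎
  where
  open ≡-Reasoning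
  v = λ j → varP (ρ zero) (f j)
  M = λ j → D.det n λ r c → varP (ρ (suc r)) (f (punchIn j c))

-- The determinant polynomial and the norms of its powers.

signed-sum : ∀ {m} (a : ℤ) (h g : Fin m → Poly n) →
  (∀ j L → ⟦ h j ⟧ L ≡ a *ℤ (sgn j *ℤ ⟦ g j ⟧ L)) →
  ∀ L → ⟦ List.foldr _⊕_ [] (List.tabulate h) ⟧ L ≡ a *ℤ ⟦ D.alt n g ⟧ L
signed-sum {n} {zero} a h g eq L = sym (trans (cong (a *ℤ_) (ev (D.alt-zero n g) L)) (ℤP.*-zeroʳ a))
signed-sum {n} {suc m} a h g eq L = begin
  ⟦ h zero ⊕ List.foldr _⊕_ [] (List.tabulate (h ∘ suc)) ⟧ L
    ≡⟨ ⟦++⟧ (h zero) _ L ⟩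
  ⟦ h zero ⟧ L +ℤ ⟦ List.foldr _⊕_ [] (List.tabulate (h ∘ suc)) ⟧ L
    -- `sgn (suc j)` unfolds to -1 times `sgn j`; the scalar `a` is general in order to absorb this
    -- sign.
    ≡⟨ cong₂ _+ℤ_ (eq zero L) (signed-sum (a *ℤ (-ℤ + 1)) (h ∘ suc) (g ∘ suc)
         (λ j L → trans (eq (suc j) L) (lemma₁ a (-ℤ + 1) (sgn j) (⟦ g (suc j) ⟧ L))) L) ⟩
  a *ℤ (+ 1 *ℤ ⟦ g zero ⟧ L) +ℤ (a *ℤ (-ℤ + 1)) *ℤ ⟦ D.alt n (g ∘ suc) ⟧ L
    ≡⟨ lemma₂ a (⟦ g zero ⟧ L) (-ℤ + 1) (⟦ D.alt n (g ∘ suc) ⟧ L) ⟩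
  a *ℤ (⟦ g zero ⟧ L +ℤ (-ℤ + 1) *ℤ ⟦ D.alt n (g ∘ suc) ⟧ L)
    ≡⟨ cong (a *ℤ_) (trans (ev (D.alt-suc n g) L) (⟦-⟧ (g zero) _ L)) ⟨
  a *ℤ ⟦ D.alt n g ⟧ L ∎
  where
  open ≡-Reasoning
  lemma₁ : ∀ a m s x → a *ℤ ((m *ℤ s) *ℤ x) ≡ (a *ℤ m) *ℤ (s *ℤ x)
  lemma₁ = solve-∀
  lemma₂ : ∀ a x m y → a *ℤ (+ 1 *ℤ x) +ℤ (a *ℤ m) *ℤ y ≡ a *ℤ (x +ℤ m *ℤ y)
  lemma₂ = solve-∀

detP≈det : ∀ m (A : Fin m → Fin m → Poly n) → detP m A ≈ₚ D.det n A
detP≈det zero A = mk λ L → refl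
detP≈det {n} (suc m) A .ev L = begin
  ⟦ List.foldr _⊕_ [] (List.map h (List.allFin (suc m))) ⟧ L
    ≡⟨ cong (λ ps → ⟦ List.foldr _⊕_ [] ps ⟧ L) (ListP.map-tabulate id h) ⟩
  ⟦ List.foldr _⊕_ [] (List.tabulate h) ⟧ L
    ≡⟨ signed-sum (+ 1) h g (λ j L → trans (⟦scaleP⟧ (sgn j) (A zero j ⊗ detP m λ r c → A (suc r) (punchIn j c)) L) (trans
         (cong (sgn j *ℤ_) (ev (⊗-cong (R.refl n {A zero j}) (detP≈det m _)) L))
         (sym (ℤP.*-identityˡ _)))) L ⟩
  + 1 *ℤ ⟦ D.det n A ⟧ L
    ≡⟨ ℤP.*-identityˡ _ ⟩
  ⟦ D.det n A ⟧ L ∎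
  where
  open ≡-Reasoning
  h g : Fin (suc m) → Poly n
  h j = scaleP (sgn j) (A zero j ⊗ detP m λ r c → A (suc r) (punchIn j c))
  g j = A zero j ⊗ D.det n λ r c → A (suc r) (punchIn j c)

powP≈^ : ∀ {p q : Poly n} → p ≈ₚ q → ∀ k → powP p k ≈ₚ D._^_ n q k
powP≈^ eq zero = mk λ L → refl
powP≈^ eq (suc k) = ⊗-cong eq (powP≈^ eq k)

⟦fromℕ-⊗⟧ : ∀ k (q : Poly n) L → ⟦ D.fromℕ n k ⊗ q ⟧ L ≡ + k *ℤ ⟦ q ⟧ L
⟦fromℕ-⊗⟧ zero q L = refl
⟦fromℕ-⊗⟧ {n} (suc k) q L = begin
  ⟦ (oneP ++ D.fromℕ n k) ⊗ q ⟧ L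
    ≡⟨ ev (R.distribʳ n q oneP (D.fromℕ n k)) L ⟩
  ⟦ (oneP ⊗ q) ++ (D.fromℕ n k ⊗ q) ⟧ L
    ≡⟨ ⟦++⟧ (oneP ⊗ q) _ L ⟩
  ⟦ oneP ⊗ q ⟧ L +ℤ ⟦ D.fromℕ n k ⊗ q ⟧ L
    ≡⟨ cong₂ _+ℤ_ (ev (⊗-identityˡ q) L) (⟦fromℕ-⊗⟧ k q L) ⟩
  ⟦ q ⟧ L +ℤ + k *ℤ ⟦ q ⟧ L
    ≡⟨ ℤP.suc-* (+ k) (⟦ q ⟧ L) ⟨
  + suc k *ℤ ⟦ q ⟧ L ∎
  where open ≡-Reasoning

norm-suc : ∀ n k → let P = powP (detX n) in ⟪ P (suc k) , P (suc k) ⟫ ≡ + rising k n *ℤ ⟪ P k , P k ⟫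
norm-suc n k = begin
  ⟪ P (suc k) , P (suc k) ⟫
    ≡⟨ ⟪⟫-cong (P≈ (suc k)) (P≈ (suc k)) ⟩
  ⟪ d ⊗ (d ^ k) , d ^ suc k ⟫
    ≡⟨ det-adjoint id id (d ^ k) (d ^ suc k) ⟩
  ⟪ d ^ k , C.detOp n id id (d ^ suc k) ⟫
    ≡⟨ ⟪⟫-cong {p = d ^ k} (R.refl n) (C.cayley n k) ⟩
  ⟪ d ^ k , D.fromℕ n (rising k n) ⊗ (d ^ k) ⟫
    ≡⟨ ⟦⟧-cong (d ^ k) (λ β → ⟦fromℕ-⊗⟧ (rising k n) (d ^ k) λ γ → ind β γ *ℤ + factM β) ⟩
  ⟦ d ^ k ⟧ (λ β → + rising k n *ℤ ⟦ d ^ k ⟧ _)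
    ≡⟨ ⟦⟧-* (d ^ k) (+ rising k n) (λ β → ⟦ d ^ k ⟧ λ γ → ind β γ *ℤ + factM β) ⟩
  + rising k n *ℤ ⟪ d ^ k , d ^ k ⟫
    ≡⟨ cong (+ rising k n *ℤ_) (⟪⟫-cong (P≈ k) (P≈ k)) ⟨
  + rising k n *ℤ ⟪ P k , P k ⟫ ∎
  where
  open ≡-Reasoning
  open D n using (_^_)
  P = powP (detX n)
  d = D.det n varP
  P≈ : ∀ k → P k ≈ₚ d ^ k
  P≈ = powP≈^ (detP≈det n varP)

-- Products of factorials.

prodUpTo-suc : ∀ n f → prodUpTo (suc n) f ≡ prodUpTo n f ℕ.* f n
prodUpTo-suc n f = begin
  product (List.map f (List.upTo (suc n)))
    ≡⟨ cong (product ∘ List.map f) (ListP.upTo-∷ʳ n) ⟨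
  product (List.map f (List.upTo n ++ n ∷ []))
    ≡⟨ cong product (ListP.map-++ f (List.upTo n) (n ∷ [])) ⟩
  product (List.map f (List.upTo n) ++ f n ∷ [])
    ≡⟨ product-++ (List.map f (List.upTo n)) (f n ∷ []) ⟩
  prodUpTo n f ℕ.* (f n ℕ.* 1)
    ≡⟨ cong (prodUpTo n f ℕ.*_) (ℕP.*-identityʳ (f n)) ⟩
  prodUpTo n f ℕ.* f n ∎
  where open ≡-Reasoning

-- The quotient of the factors at `i` is k + 1 + i, and `rising k n` is the product of these over i
-- < n.
prodUpTo-! : ∀ k n → prodUpTo n (λ i → (suc k ℕ.+ i) !) ≡ rising k n ℕ.* prodUpTo n (λ i → (k ℕ.+ i) !)
prodUpTo-! k zero    = refl
prodUpTo-! k (suc n) = begin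
  prodUpTo (suc n) (λ i → (suc k ℕ.+ i) !)
    ≡⟨ prodUpTo-suc n _ ⟩
  prodUpTo n (λ i → (suc k ℕ.+ i) !) ℕ.* (suc (k ℕ.+ n) ℕ.* (k ℕ.+ n) !)
    ≡⟨ cong₂ (λ x y → x ℕ.* (y ℕ.* (k ℕ.+ n) !)) (prodUpTo-! k n) (sym (ℕP.+-suc k n)) ⟩
  rising k n ℕ.* F n ℕ.* ((k ℕ.+ suc n) ℕ.* (k ℕ.+ n) !)
    ≡⟨ interchange (rising k n) (F n) (k ℕ.+ suc n) ((k ℕ.+ n) !) ⟩
  rising k (suc n) ℕ.* (F n ℕ.* (k ℕ.+ n) !)
    ≡⟨ cong (rising k (suc n) ℕ.*_) (prodUpTo-suc n _) ⟨
  rising k (suc n) ℕ.* F (suc n) ∎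
  where
  open ≡-Reasoning
  open import Algebra.Properties.CommutativeSemigroup ℕP.*-commutativeSemigroup using (interchange)
  F = λ n → prodUpTo n λ i → (k ℕ.+ i) !

factM-zeroM : ∀ n → factM (zeroM {n}) ≡ 1
factM-zeroM n = product-replicate n _ (product-replicate n _! refl)
  where
  product-replicate : ∀ {A : Set} m (g : A → ℕ) {x} → g x ≡ 1 →
                      product (Vec.toList (Vec.map g (Vec.replicate m x))) ≡ 1
  product-replicate zero    g eq = refl
  product-replicate (suc m) g eq = cong₂ ℕ._*_ eq (product-replicate m g eq)

-- Clearing the denominator keeps the induction within the integers. The right side obeys the
-- recursion of the norms by `prodUpTo-!`, and at k = 0 it is the denominator itself, as the
-- constant 1 has norm 1.
norm-power : ∀ n k → let P = powP (detX n) k in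
             ⟪ P , P ⟫ *ℤ + prodUpTo n _! ≡ + prodUpTo n (λ i → (k ℕ.+ i) !)
norm-power n zero = trans (cong (_*ℤ + prodUpTo n _!) norm-one) (ℤP.*-identityˡ _)
  where
  norm-one : ⟪ oneP {n} , oneP ⟫ ≡ + 1
  norm-one = trans (⟦oneP⟧ {n} λ β → ⟦ oneP ⟧ λ γ → ind β γ *ℤ + factM β)
    (trans (⟦oneP⟧ {n} λ γ → ind zeroM γ *ℤ + factM (zeroM {n}))
    (cong₂ (λ x y → x *ℤ + y) (ind-refl (zeroM {n})) (factM-zeroM n)))
norm-power n (suc k) = begin
  ⟪ P (suc k) , P (suc k) ⟫ *ℤ + prodUpTo n _!
    ≡⟨ cong (_*ℤ + prodUpTo n _!) (norm-suc n k) ⟩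
  (+ rising k n *ℤ ⟪ P k , P k ⟫) *ℤ + prodUpTo n _!
    ≡⟨ ℤP.*-assoc (+ rising k n) ⟪ P k , P k ⟫ (+ prodUpTo n _!) ⟩
  + rising k n *ℤ (⟪ P k , P k ⟫ *ℤ + prodUpTo n _!)
    ≡⟨ cong (+ rising k n *ℤ_) (norm-power n k) ⟩
  + rising k n *ℤ + prodUpTo n (λ i → (k ℕ.+ i) !)
    ≡⟨ ℤP.pos-* (rising k n) _ ⟨
  + (rising k n ℕ.* prodUpTo n (λ i → (k ℕ.+ i) !))
    ≡⟨ cong +_ (prodUpTo-! k n) ⟨
  + prodUpTo n (λ i → (suc k ℕ.+ i) !) ∎
  where
  open ≡-Reasoning
  P = powP (detX n)

-- Homogeneity of powers of the determinant.

Homogeneous : ℕ → Poly n → Set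
Homogeneous d = All λ t → ∣ proj₂ t ∣M ≡ d

sum-zipWith : ∀ {m} (u v : Vec ℕ m) → Vec.sum (Vec.zipWith ℕ._+_ u v) ≡ Vec.sum u ℕ.+ Vec.sum v
sum-zipWith Vec.[] Vec.[] = refl
sum-zipWith (x Vec.∷ u) (y Vec.∷ v) = trans (cong ((x ℕ.+ y) ℕ.+_) (sum-zipWith u v))
  (interchange x y (Vec.sum u) (Vec.sum v))
  where open import Algebra.Properties.CommutativeSemigroup ℕP.+-commutativeSemigroup using (interchange)

∣addM∣ : ∀ (β γ : Mon n) → ∣ addM β γ ∣M ≡ ∣ β ∣M ℕ.+ ∣ γ ∣M
∣addM∣ β γ = trans (cong Vec.sum (map-sum β γ)) (sum-zipWith (Vec.map Vec.sum β) (Vec.map Vec.sum γ))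
  where
  map-sum : ∀ {r m} (β γ : Vec (Vec ℕ r) m) → Vec.map Vec.sum (Vec.zipWith (Vec.zipWith ℕ._+_) β γ) ≡
            Vec.zipWith ℕ._+_ (Vec.map Vec.sum β) (Vec.map Vec.sum γ)
  map-sum Vec.[] Vec.[] = refl
  map-sum (u Vec.∷ β) (v Vec.∷ γ) = cong₂ Vec._∷_ (sum-zipWith u v) (map-sum β γ)

-- Since `zeroM` is idempotent under `addM`, its degree d satisfies d + d = d + 0.
∣zeroM∣ : ∀ n → ∣ zeroM {n} ∣M ≡ 0
∣zeroM∣ n = ℕP.+-cancelˡ-≡ ∣ zeroM {n} ∣M ∣ zeroM {n} ∣M 0 (trans (sym (∣addM∣ (zeroM {n}) zeroM))
  (trans (cong ∣_∣M (addM-identityˡ (zeroM {n}))) (sym (ℕP.+-identityʳ ∣ zeroM {n} ∣M))))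

sum-updateAt : ∀ {m} (v : Vec ℕ m) i → Vec.sum (Vec.updateAt v i suc) ≡ suc (Vec.sum v)
sum-updateAt (x Vec.∷ v) zero    = refl
sum-updateAt (x Vec.∷ v) (suc i) = trans (cong (x ℕ.+_) (sum-updateAt v i)) (ℕP.+-suc x _)

∣unitM∣ : ∀ (i j : Fin n) → ∣ unitM i j ∣M ≡ 1
∣unitM∣ {n} i j = begin
  ∣ unitM i j ∣M                              ≡⟨ cong ∣_∣M (trans (addM-comm (unitM i j) zeroM) (addM-identityˡ (unitM i j))) ⟨
  ∣ addM (unitM i j) zeroM ∣M                 ≡⟨ cong ∣_∣M (addM-unitM i j zeroM) ⟩
  ∣ raise i j zeroM ∣M                        ≡⟨ cong Vec.sum 
    (VecP.map-updateAt {g = λ r → Vec.updateAt r j suc} {h = suc} zeroM i (sum-updateAt (lookup (zeroM {n}) i) j)) ⟩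
  Vec.sum (Vec.updateAt (Vec.map Vec.sum (zeroM {n})) i suc)  ≡⟨ sum-updateAt (Vec.map Vec.sum (zeroM {n})) i ⟩
  suc ∣ zeroM {n} ∣M                          ≡⟨ cong suc (∣zeroM∣ n) ⟩
  1                                           ∎
  where open ≡-Reasoning

⊗-homogeneous : ∀ {d e} {p q : Poly n} → Homogeneous d p → Homogeneous e q → Homogeneous (d ℕ.+ e) (p ⊗ q)
⊗-homogeneous hp hq = AllP.concat⁺ (AllP.map⁺ (All.map (λ {t} eq → AllP.map⁺
  (All.map (λ {s} eq′ → trans (∣addM∣ (proj₂ t) (proj₂ s)) (cong₂ ℕ._+_ eq eq′)) hq)) hp))

detP-homogeneous : ∀ m (A : Fin m → Fin m → Poly n) → (∀ i j → Homogeneous 1 (A i j)) → Homogeneous m (detP m A)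
detP-homogeneous {n} zero    A hA = ∣zeroM∣ n ∷ []
detP-homogeneous {n} (suc m) A hA = sum-homogeneous (List.allFin (suc m)) λ j → AllP.map⁺
  (⊗-homogeneous (hA zero j) (detP-homogeneous m _ λ r c → hA (suc r) (punchIn j c)))
  where
  sum-homogeneous : ∀ {d} {A : Set} {h : A → Poly n} xs → (∀ x → Homogeneous d (h x)) →
                    Homogeneous d (List.foldr _⊕_ [] (List.map h xs))
  sum-homogeneous []       hh = []
  sum-homogeneous (x ∷ xs) hh = AllP.++⁺ (hh x) (sum-homogeneous xs hh)

powP-homogeneous : ∀ {d} {p : Poly n} → Homogeneous d p → ∀ k → Homogeneous (k ℕ.* d) (powP p k)
powP-homogeneous {n} hp zero    = ∣zeroM∣ n ∷ []
powP-homogeneous     hp (suc k) = ⊗-homogeneous hp (powP-homogeneous hp k)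

-- Sums over the multiindices of degree `d` sift correctly only in that degree, so functionals have
-- to be compared there alone.
⟦⟧-cong-homogeneous : ∀ {d} {p : Poly n} → Homogeneous d p → ∀ {L M} →
                      (∀ β → ∣ β ∣M ≡ d → L β ≡ M β) → ⟦ p ⟧ L ≡ ⟦ p ⟧ M
⟦⟧-cong-homogeneous [] eq = refl
⟦⟧-cong-homogeneous {p = (c , β) ∷ p} (h ∷ hp) eq =
  cong₂ _+ℤ_ (cong (c *ℤ_) (eq β h)) (⟦⟧-cong-homogeneous hp eq)

-- The enumeration of multiindices.

ι : ∀ {P : Set} → Dec P → ℤ
ι d = if ⌊ d ⌋ then + 1 else + 0

-- Multiplicity one, expressed by the sifting property of the Kronecker delta.
record Once {A : Set} (_≟_ : DecidableEquality A) (xs : List A) (b : A) : Set where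
  constructor mk
  field sifts : ∀ (g : A → ℤ) → sumℤ (List.map (λ a → ι (a ≟ b) *ℤ g a) xs) ≡ g b
open Once

sumℤ-cong : ∀ {A : Set} {f g : A → ℤ} → (∀ a → f a ≡ g a) → ∀ xs → sumℤ (List.map f xs) ≡ sumℤ (List.map g xs)
sumℤ-cong eq xs = cong sumℤ (ListP.map-cong eq xs)

sumℤ-++ : ∀ xs ys → sumℤ (xs ++ ys) ≡ sumℤ xs +ℤ sumℤ ys
sumℤ-++ []       ys = sym (ℤP.+-identityˡ _)
sumℤ-++ (x ∷ xs) ys = trans (cong (x +ℤ_) (sumℤ-++ xs ys)) (sym (ℤP.+-assoc x _ _))

sumℤ-* : ∀ {A : Set} a (f : A → ℤ) xs → sumℤ (List.map (λ x → a *ℤ f x) xs) ≡ a *ℤ sumℤ (List.map f xs)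
sumℤ-* a f []       = sym (ℤP.*-zeroʳ a)
sumℤ-* a f (x ∷ xs) = trans (cong (a *ℤ f x +ℤ_) (sumℤ-* a f xs)) (sym (ℤP.*-distribˡ-+ a (f x) _))

sumℤ-concatMap : ∀ {A B : Set} (f : B → ℤ) (h : A → List B) xs →
  sumℤ (List.map f (concatMap h xs)) ≡ sumℤ (List.map (λ a → sumℤ (List.map f (h a))) xs)
sumℤ-concatMap f h []       = refl
sumℤ-concatMap f h (x ∷ xs) = trans (cong sumℤ (ListP.map-++ f (h x) (concatMap h xs)))
  (trans (sumℤ-++ (List.map f (h x)) _) (cong (sumℤ (List.map f (h x)) +ℤ_) (sumℤ-concatMap f h xs)))

ι-× : ∀ {P Q S : Set} (p : Dec P) (q : Dec Q) (s : Dec S) → (P → Q → S) → (S → P × Q) → ι s ≡ ι p *ℤ ι q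
ι-× (yes p) (yes q) (yes s) f g = refl
ι-× (yes p) (yes q) (no ¬s) f g = ⊥-elim (¬s (f p q))
ι-× (yes p) (no ¬q) (yes s) f g = ⊥-elim (¬q (proj₂ (g s)))
ι-× (yes p) (no ¬q) (no ¬s) f g = refl
ι-× (no ¬p) q       (yes s) f g = ⊥-elim (¬p (proj₁ (g s)))
ι-× (no ¬p) q       (no ¬s) f g = refl

-- The delta of two nonempty vectors is the product of the deltas of heads and tails. The sum over
-- the combined list thus sifts the tail in its inner sum and the head in its outer one.
once-∷ : ∀ {A : Set} (_≟_ : DecidableEquality A) {m} {xs : List A} {ys : List (Vec A m)} {x v} →
  Once _≟_ xs x → Once (VecP.≡-dec _≟_) ys v →
  Once (VecP.≡-dec _≟_) (concatMap (λ a → List.map (a Vec.∷_) ys) xs) (x Vec.∷ v)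
once-∷ _≟_ {xs = xs} {ys} {x} {v} onceˣ onceʸ .sifts g = begin
  sumℤ (List.map G (concatMap (λ a → List.map (a Vec.∷_) ys) xs))
    ≡⟨ sumℤ-concatMap G _ xs ⟩
  sumℤ (List.map (λ a → sumℤ (List.map G (List.map (a Vec.∷_) ys))) xs)
    ≡⟨ sumℤ-cong (λ a → trans (cong sumℤ (sym (ListP.map-∘ ys))) (trans
         (sumℤ-cong (λ u → trans
           (cong (_*ℤ g (a Vec.∷ u)) (ι-× (a ≟ x) (u ≟ᵛ v) ((a Vec.∷ u) ≟ᵛ (x Vec.∷ v)) (cong₂ Vec._∷_) VecP.∷-injective))
           (ℤP.*-assoc (ι (a ≟ x)) (ι (u ≟ᵛ v)) (g (a Vec.∷ u)))) ys)
         (trans (sumℤ-* (ι (a ≟ x)) (λ u → ι (u ≟ᵛ v) *ℤ g (a Vec.∷ u)) ys)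
           (cong (ι (a ≟ x) *ℤ_) (sifts onceʸ (g ∘ (a Vec.∷_))))))) xs ⟩
  sumℤ (List.map (λ a → ι (a ≟ x) *ℤ g (a Vec.∷ v)) xs)
    ≡⟨ sifts onceˣ (λ a → g (a Vec.∷ v)) ⟩
  g (x Vec.∷ v) ∎
  where
  open ≡-Reasoning
  _≟ᵛ_ : ∀ {m} → DecidableEquality (Vec _ m)
  _≟ᵛ_ = VecP.≡-dec _≟_
  G = λ u → ι (u ≟ᵛ (x Vec.∷ v)) *ℤ g u

once-upTo : ∀ m {x} → x ℕ.< m → Once ℕP._≟_ (List.upTo m) x
once-upTo m {x} x<m .sifts g = trans (cong sumℤ (ListP.map-upTo G m)) (trans (single G m x<m off) on)
  where
  G = λ a → ι (a ℕP.≟ x) *ℤ g a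
  off : ∀ y → ¬ y ≡ x → G y ≡ + 0
  off y ne with y ℕP.≟ x
  ... | yes eq = ⊥-elim (ne eq)
  ... | no _ = refl
  on : G x ≡ g x
  on with x ℕP.≟ x
  ... | yes _ = ℤP.*-identityˡ _
  ... | no ne = ⊥-elim (ne refl)
  vanish : ∀ (G : ℕ → ℤ) m → (∀ y → G y ≡ + 0) → sumℤ (List.applyUpTo G m) ≡ + 0
  vanish G zero    eq = refl
  vanish G (suc m) eq = cong₂ _+ℤ_ (eq 0) (vanish (G ∘ suc) m (eq ∘ suc))
  single : ∀ (G : ℕ → ℤ) m {x} → x ℕ.< m → (∀ y → ¬ y ≡ x → G y ≡ + 0) → sumℤ (List.applyUpTo G m) ≡ G x
  single G (suc m) {zero}  _           off = trans
    (cong (G 0 +ℤ_) (vanish (G ∘ suc) m λ y → off (suc y) λ ())) (ℤP.+-identityʳ _)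
  single G (suc m) {suc x} (ℕ.s≤s x<m) off = trans
    (cong₂ _+ℤ_ (off 0 λ ()) (single (G ∘ suc) m x<m λ y ne → off (suc y) (ne ∘ ℕP.suc-injective)))
    (ℤP.+-identityˡ _)

once-boxVecs : ∀ b {m} (v : Vec ℕ m) → (∀ i → lookup v i ℕ.≤ b) → Once (VecP.≡-dec ℕP._≟_) (boxVecs b m) v
once-boxVecs b Vec.[]      le .sifts g = trans (ℤP.+-identityʳ _) (ℤP.*-identityˡ _)
once-boxVecs b (x Vec.∷ v) le = once-∷ ℕP._≟_ (once-upTo (suc b) (ℕ.s≤s (le zero))) (once-boxVecs b v (le ∘ suc))

once-boxMats : ∀ {r m} (rows : List (Vec ℕ r)) (β : Vec (Vec ℕ r) m) →
  (∀ i → Once (VecP.≡-dec ℕP._≟_) rows (lookup β i)) → Once (VecP.≡-dec (VecP.≡-dec ℕP._≟_)) (boxMats rows m) β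
once-boxMats rows Vec.[]      once .sifts g = trans (ℤP.+-identityʳ _) (ℤP.*-identityˡ _)
once-boxMats rows (u Vec.∷ β) once = once-∷ (VecP.≡-dec ℕP._≟_) (once zero) (once-boxMats rows β (once ∘ suc))

sumℤ-filterᵇ : ∀ {A : Set} (q : A → Bool) (f : A → ℤ) xs →
  sumℤ (List.map f (List.filterᵇ q xs)) ≡ sumℤ (List.map (λ a → if q a then f a else + 0) xs)
sumℤ-filterᵇ q f []       = refl
sumℤ-filterᵇ q f (x ∷ xs) with q x
... | true  = cong (f x +ℤ_) (sumℤ-filterᵇ q f xs)
... | false = trans (sumℤ-filterᵇ q f xs) (sym (ℤP.+-identityˡ _))

-- The test is moved into the function being sifted, where it is evaluated only at `b`.
once-filterᵇ : ∀ {A : Set} (_≟_ : DecidableEquality A) (q : A → Bool) {xs b} → q b ≡ true →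
               Once _≟_ xs b → Once _≟_ (List.filterᵇ q xs) b
once-filterᵇ _≟_ q {xs} {b} qb once .sifts g = begin
  sumℤ (List.map (λ a → ι (a ≟ b) *ℤ g a) (List.filterᵇ q xs))
    ≡⟨ sumℤ-filterᵇ q (λ a → ι (a ≟ b) *ℤ g a) xs ⟩
  sumℤ (List.map (λ a → if q a then ι (a ≟ b) *ℤ g a else + 0) xs)
    ≡⟨ sumℤ-cong (λ a → pull (q a) (ι (a ≟ b)) (g a)) xs ⟩
  sumℤ (List.map (λ a → ι (a ≟ b) *ℤ (if q a then g a else + 0)) xs)
    ≡⟨ sifts once (λ a → if q a then g a else + 0) ⟩
  (if q b then g b else + 0)
    ≡⟨ cong (λ t → if t then g b else + 0) qb ⟩
  g b ∎
  where
  open ≡-Reasoning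
  pull : ∀ t x y → (if t then x *ℤ y else + 0) ≡ x *ℤ (if t then y else + 0)
  pull true  x y = refl
  pull false x y = sym (ℤP.*-zeroʳ x)

lookup≤sum : ∀ {m} (v : Vec ℕ m) i → lookup v i ℕ.≤ Vec.sum v
lookup≤sum (x Vec.∷ v) zero    = ℕP.m≤m+n x _
lookup≤sum (x Vec.∷ v) (suc i) = ℕP.≤-trans (lookup≤sum v i) (ℕP.m≤n+m _ x)

-- Every entry of `β` is bounded by its total degree, so `β` lies in the box of side bound `d`.
once-multiindices : ∀ {d} (β : Mon n) → ∣ β ∣M ≡ d → Once _≟M_ (multiindices n d) β
once-multiindices {n} {d} β eq = once-filterᵇ _≟M_ (λ α → ⌊ ∣ α ∣M ℕP.≟ d ⌋)
  {xs = boxMats (boxVecs d n) n} (trans (isYes≗does _) (dec-true (∣ β ∣M ℕP.≟ d) eq))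
  (once-boxMats (boxVecs d n) β λ i → once-boxVecs d (lookup β i) λ j → begin
    lookup (lookup β i) j           ≤⟨ lookup≤sum (lookup β i) j ⟩
    Vec.sum (lookup β i)            ≡⟨ VecP.lookup-map i Vec.sum β ⟨
    lookup (Vec.map Vec.sum β) i    ≤⟨ lookup≤sum (Vec.map Vec.sum β) i ⟩
    ∣ β ∣M                          ≡⟨ eq ⟩
    d                               ∎)
  where open ℕP.≤-Reasoning

-- The coefficient sum as a Fischer norm.

coeff≡⟦⟧ : ∀ (α : Mon n) p → coeff α p ≡ ⟦ p ⟧ (ind α)
coeff≡⟦⟧ α [] = refl
coeff≡⟦⟧ α ((c , β) ∷ p) = cong₂ _+ℤ_ (if≡* ⌊ α ≟M β ⌋) (coeff≡⟦⟧ α p)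
  where
  if≡* : ∀ t → (if t then c else + 0) ≡ c *ℤ (if t then + 1 else + 0)
  if≡* true  = sym (ℤP.*-identityʳ c)
  if≡* false = sym (ℤP.*-zeroʳ c)

sumℤ-⟦⟧ : ∀ {A : Set} (p : Poly n) (F : A → Mon n → ℤ) xs →
  sumℤ (List.map (λ a → ⟦ p ⟧ (F a)) xs) ≡ ⟦ p ⟧ (λ β → sumℤ (List.map (λ a → F a β) xs))
sumℤ-⟦⟧ p F []       = sym (⟦⟧-0 p λ β → refl)
sumℤ-⟦⟧ p F (x ∷ xs) = trans (cong (⟦ p ⟧ (F x) +ℤ_) (sumℤ-⟦⟧ p F xs)) (sym (⟦⟧-+ p _ _))

-- One factor `coeff α p` becomes an evaluation of `p` at `ind α`, and the sum over `α` moves inside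
-- it. Homogeneity puts every monomial of `p` in the enumeration, so the delta sifts; expanding the
-- other coefficient gives the pairing.
sum-multiindices : ∀ {d} (p : Poly n) → Homogeneous d p →
  sumℤ (List.map (λ α → coeff α p *ℤ coeff α p *ℤ + factM α) (multiindices n d)) ≡ ⟪ p , p ⟫
sum-multiindices {n} {d} p hp = begin
  sumℤ (List.map (λ α → coeff α p *ℤ coeff α p *ℤ + factM α) (multiindices n d))
    ≡⟨ sumℤ-cong (λ α → trans
         (rearrange (coeff α p) (+ factM α))
         (trans (cong (w α *ℤ_) (coeff≡⟦⟧ α p)) (trans (sym (⟦⟧-* p (w α) (ind α)))
           (⟦⟧-cong p λ β → ℤP.*-comm (w α) (ind α β)))))
         (multiindices n d) ⟩
  sumℤ (List.map (λ α → ⟦ p ⟧ λ β → ind α β *ℤ w α) (multiindices n d))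
    ≡⟨ sumℤ-⟦⟧ p (λ α β → ind α β *ℤ w α) (multiindices n d) ⟩
  ⟦ p ⟧ (λ β → sumℤ (List.map (λ α → ind α β *ℤ w α) (multiindices n d)))
    ≡⟨ ⟦⟧-cong-homogeneous hp (λ β eq → sifts (once-multiindices β eq) w) ⟩
  ⟦ p ⟧ w
    ≡⟨ ⟦⟧-cong p (λ β → trans (cong (+ factM β *ℤ_) (coeff≡⟦⟧ β p)) (trans (sym (⟦⟧-* p (+ factM β) (ind β)))
         (⟦⟧-cong p λ γ → ℤP.*-comm (+ factM β) (ind β γ)))) ⟩
  ⟪ p , p ⟫ ∎
  where
  open ≡-Reasoning
  w : Mon n → ℤ
  w α = + factM α *ℤ coeff α p
  rearrange : ∀ c x → c *ℤ c *ℤ x ≡ (x *ℤ c) *ℤ c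
  rearrange = solve-∀

theorem2 : (n k : ℕ) → 1 ≤ n →
    sumℤ (map (λ α → cCoeff n k α *ℤ cCoeff n k α *ℤ + factM α) (multiindices n (k * n)))
    *ℤ + prodUpTo n (λ i → i !)
    ≡ + prodUpTo n (λ i → (k + i) !)
theorem2 n k _ = trans
  (cong (_*ℤ + prodUpTo n _!) (sum-multiindices (powP (detX n) k) (powP-homogeneous
    (detP-homogeneous n varP λ i j → ∣unitM∣ i j ∷ []) k)))
  (norm-power n k)
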